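{- Let $\mathbf{T}$ be a pile of quadrangulations of a polygon such that $\varkappa=\varkappa(\mathbf{T})$ is comfortable. Then every coherent solution $\mathbf{x}=(x_s)_{s\in\varkappa^0}$ of the Kashaev equation with all components nonzero and with $x_{v_1}x_{v_3}+x_{v_2}x_{v_4}\neq0$ for every $2$-face of $\varkappa$ with vertices $v_1,v_2,v_3,v_4$ in cyclic order can be extended to an array $\tilde{\mathbf{x}}=(x_s)_{s\in\varkappa^{02}}$ satisfying the K-hexahedron equations.
   Context: A quadrangulation of a polygon $R\subset\mathbb{R}^2$ is a face-to-face tiling by quadrilaterals. A flip replaces three quadrilaterals forming a hexagon with common degree-$3$ interior vertex $w$ by the other subdivision of the hexagon into three quadrilaterals (new interior vertex $v$). A pile is a sequence $(T_0,\dots,T_\ell)$ with consecutive quadrangulations related by a flip. $\varkappa(\mathbf{T})$: start with $T_0$; for each flip add the new vertex $v$ and a $3$-cube with vertices $w,v$ and the six hexagon vertices, whose $2$-faces are the three old and three new quadrilaterals, with bottom vertex $w$ and top vertex $v$. $\varkappa^0,\varkappa^2,\varkappa^3$: vertices, $2$-faces, $3$-cubes; $\varkappa^{02}=\varkappa^0\cup\varkappa^2$. A vertex is interior if it has a neighbourhood homeomorphic to an open ball in $\mathbb{R}^3$. Comfortable: with $\sim$ the equivalence relation on $\varkappa^2$ generated by opposite faces of $3$-cubes, $\varkappa_\boxdot$ its classes, and $\psi_\varkappa(\mathbf{t})_C=t_{[a]}t_{[b]}t_{[c]}$ ($a,b,c$ representing the three pairs of opposite faces of $C$), every $\mathbf{u}\in\{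 -1,1\}^{\varkappa^3}$ with $\prod_{C\ni v}u_C=1$ for all interior vertices $v$ lies in the image of $\psi_\varkappa$ (the converse always holds). For a $3$-cube $C$ with vertex values $z_{ijk}$ (cube isomorphism $C\cong\{0,1\}^3$): $K^C=2(a^2+b^2+c^2+d^2)-(a+b+c+d)^2-4(s+t)$ with $a=z_{000}z_{111}$, $b=z_{100}z_{011}$, $c=z_{010}z_{101}$, $d=z_{001}z_{110}$, $s=z_{000}z_{011}z_{101}z_{110}$, $t=z_{111}z_{100}z_{010}z_{001}$; for a vertex $v$ labeled $000$, $K^C_v=\frac12(z_{111}z_{000}^2-z_{000}(z_{100}z_{011}+z_{010}z_{101}+z_{001}z_{110}))-z_{100}z_{010}z_{001}$. A coherent solution of the Kashaev equation: $K^C(\mathbf{x})=0$ for all $3$-cubes, and for every interior vertex $v$, $\prod_{C\ni v}K^C_v(\mathbf{x})=\prod_{S\ni v}(x_vx_{v_2}+x_{v_1}x_{v_3})$ (over $3$-cubes and $2$-faces containing $v$; $v,v_1,v_2,v_3$ in cyclic order on $S$). K-hexahedron equations for $\tilde{\mathbf{x}}$ (nonzero on vertices): $x_s^2=x_{v_1}x_{v_3}+x_{v_2}x_{v_4}$ for each $2$-face $s$ (vertices in cyclic order), and for each $3$-cube, identified with $[0,1]^3$ with bottom $000$ and top $111$, with $z_{ijk}$ vertex values and $z_p$ the value at the face centered at $p$: $z_{1\frac12\frac12}=(z_{\frac120\frac12}z_{\frac12\frac120}+z_{0\frac12\frac12}z_{100})/z_{000}$, $z_{\frac121\frac12}=(z_{0\frac12\frac12}z_{\frac12\frac120}+z_{\frac120\frac12}z_{010})/z_{000}$,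 $z_{\frac12\frac121}=(z_{0\frac12\frac12}z_{\frac120\frac12}+z_{\frac12\frac120}z_{001})/z_{000}$, $z_{111}=(A+2z_{0\frac12\frac12}z_{\frac120\frac12}z_{\frac12\frac120})/z_{000}^2$, $A=2z_{100}z_{010}z_{001}+z_{000}(z_{100}z_{011}+z_{010}z_{101}+z_{001}z_{110})$. -}

module Defs where

open import Level using (Level; _⊔_) renaming (suc to lsuc)
open import Algebra.Apartness.Bundles using (HeytingField)
open import Data.Bool using (Bool; true; false; if_then_else_; _xor_)
open import Data.Fin using (Fin; zero; suc; _↑ʳ_; _≟_; _<?_)
open import Data.Fin.Patterns using (0F; 1F; 2F)
open import Data.Fin.Properties using (any?)
open import Data.List using (List; []; _∷_; _++_; [_]; map; foldr; filter; length; zip; allFin; cartesianProduct)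
open import Data.List.Membership.Propositional using (_∈_; _∉_)
open import Data.List.Relation.Unary.Unique.Propositional using (Unique)
open import Data.Nat using (ℕ; _≤_) renaming (_+_ to infixl 6 _+ℕ_)
open import Data.Product using (Σ-syntax; ∃-syntax; _×_; _,_; proj₁; proj₂)
open import Data.Product.Properties using (≡-dec)
open import Data.Sign using (Sign) renaming (_*_ to _*ₛ_; + to 1ₛ)
open import Data.Sum using (_⊎_; inj₁; inj₂)
open import Data.Vec as Vec using (Vec; []; _∷_; toList)
open import Relation.Binary.Construct.Closure.Equivalence using (EqClosure)
open import Relation.Binary.PropositionalEquality using (_≡_)
open import Relation.Nullary using (¬_; Dec; does)
open import Relation.Nullary.Decidable using (_⊎-dec_; _×-dec_)
import Data.List.Membership.DecPropositional as DecMembership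

private
  variable
    n m : ℕ

sides : {V : Set} → List V → List (V × V)
sides []       = []
sides (v ∷ vs) = zip (v ∷ vs) (vs ++ [ v ])

-- Edges are undirected and determined by their two end points.
Side : {V : Set} → List V → V → V → Set
Side p a b = (a , b) ∈ sides p ⊎ (b , a) ∈ sides p

_∈?_ : (a : Fin n) (p : List (Fin n)) → Dec (a ∈ p)
_∈?_ = DecMembership._∈?_ _≟_

side? : (p : List (Fin n)) (a b : Fin n) → Dec (Side p a b)
side? p a b = ((a , b) ∈ₑ? sides p) ⊎-dec ((b , a) ∈ₑ? sides p)
  where open DecMembership (≡-dec _≟_ _≟_) renaming (_∈?_ to _∈ₑ?_)

-- The four vertices of a quadrilateral, in cyclic order.
Quad : Set → Set
Quad V = Vec V 4

-- Equality of quadrilaterals: the cyclic order matters only up to the choice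
-- of the starting vertex and of the direction.
infix 4 _≋_
_≋_ : {V : Set} → Quad V → Quad V → Set
q ≋ (a ∷ b ∷ c ∷ d ∷ []) =
  q ∈ (a ∷ b ∷ c ∷ d ∷ []) ∷ (b ∷ c ∷ d ∷ a ∷ []) ∷ (c ∷ d ∷ a ∷ b ∷ []) ∷ (d ∷ a ∷ b ∷ c ∷ [])
    ∷ (d ∷ c ∷ b ∷ a ∷ []) ∷ (c ∷ b ∷ a ∷ d ∷ []) ∷ (b ∷ a ∷ d ∷ c ∷ []) ∷ (a ∷ d ∷ c ∷ b ∷ []) ∷ []

-- The boundary of R in cyclic order.  A vertex of a tiling lying on a straight
-- side of R is listed too.
record Polygon (n : ℕ) : Set where
  field
    boundary : List (Fin n)
    distinct : Unique boundary
    3≤length : 3 ≤ length boundary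

-- A tiling of R is recorded up to isotopy, as a cell complex: vertices are
-- labelled by Fin n and tiles by Fin m, and edges are pairs of vertices.  The
-- last six conditions say that the tiles, glued along their common edges, form
-- a closed disk with boundary R: a compact connected surface with non-empty
-- boundary is a disk exactly when its Euler characteristic is 1.
record Quadrangulation {n : ℕ} (R : Polygon n) (m : ℕ) : Set where
  open Polygon R
  field
    corners : Fin m → Quad (Fin n)

  Edge : Fin m → Fin n → Fin n → Set
  Edge f = Side (toList (corners f))

  edge? : (f : Fin m) (a b : Fin n) → Dec (Edge f a b)
  edge? f = side? (toList (corners f))

  tilesAtEdge : Fin n → Fin n → List (Fin m)
  tilesAtEdge a b = filter (λ f → edge? f a b) (allFin m)

  edges : List (Fin n × Fin n)
  edges = filter (λ (a , b) → (a <? b) ×-dec any? (λ f → edge? f a b))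
                 (cartesianProduct (allFin n) (allFin n))

  field
    corners-distinct : ∀ f → Unique (toList (corners f))
    vertices-covered : ∀ a → ∃[ f ] a ∈ toList (corners f)
    boundary-edge    : ∀ a b → Side boundary a b → length (tilesAtEdge a b) ≡ 1
    inner-edge       : ∀ a b → ¬ Side boundary a b → ∃[ f ] Edge f a b → length (tilesAtEdge a b) ≡ 2
    locally-connected : ∀ a f g → a ∈ toList (corners f) → a ∈ toList (corners g) →
                        EqClosure (λ f′ g′ → ∃[ b ] (Edge f′ a b × Edge g′ a b)) f g
    connected        : ∀ f g → EqClosure (λ f′ g′ → ∃[ a ] ∃[ b ] (Edge f′ a b × Edge g′ a b)) f g
    euler            : n +ℕ m ≡ length edges +ℕ 1

-- The hexagon is e₁ e₁₂ e₂ e₂₃ e₃ e₁₃, with e₁, e₂, e₃ the neighbours of the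
-- removed vertex w.  A quadrangulation and its flip have equally many vertices
-- and tiles, so both use the same labels: in T′ the label w denotes the new
-- vertex v, and the label tᵢ denotes the new tile opposite (in the 3-cube) to
-- the old tile tᵢ.  In the complex ϰ below, old and new cells are distinct.
record Flip {n m : ℕ} {R : Polygon n} (T T′ : Quadrangulation R m) : Set where
  private
    module T  = Quadrangulation T
    module T′ = Quadrangulation T′
  field
    w e₁ e₂ e₃ e₁₂ e₁₃ e₂₃ : Fin n
    t₁ t₂ t₃               : Fin m
    vertices-distinct      : Unique (w ∷ e₁ ∷ e₁₂ ∷ e₂ ∷ e₂₃ ∷ e₃ ∷ e₁₃ ∷ [])
    w-interior             : w ∉ Polygon.boundary R
    degree-3               : ∀ f → w ∈ toList (T.corners f) → f ∈ t₁ ∷ t₂ ∷ t₃ ∷ []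
    old₁                   : T.corners t₁ ≋ w ∷ e₂ ∷ e₂₃ ∷ e₃ ∷ []
    old₂                   : T.corners t₂ ≋ w ∷ e₁ ∷ e₁₃ ∷ e₃ ∷ []
    old₃                   : T.corners t₃ ≋ w ∷ e₁ ∷ e₁₂ ∷ e₂ ∷ []
    new₁                   : T′.corners t₁ ≋ w ∷ e₁₂ ∷ e₁ ∷ e₁₃ ∷ []
    new₂                   : T′.corners t₂ ≋ w ∷ e₁₂ ∷ e₂ ∷ e₂₃ ∷ []
    new₃                   : T′.corners t₃ ≋ w ∷ e₁₃ ∷ e₃ ∷ e₂₃ ∷ []
    unchanged              : ∀ f → f ∉ t₁ ∷ t₂ ∷ t₃ ∷ [] → T′.corners f ≡ T.corners f

-- Piles (T₀, …, T_ℓ), indexed by T_ℓ.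
infixl 5 _▷_
data Pile {n m : ℕ} {R : Polygon n} : Quadrangulation R m → Set where
  ⟨_⟩ : ∀ T → Pile T
  _▷_ : ∀ {T T′} → Pile T → Flip T T′ → Pile T′

pattern O = false
pattern I = true

-- A 3-cube with a fixed identification with [0,1]³: vertex i j k is the vertex
-- (i,j,k), and face₁ i, face₂ j, face₃ k are the faces centred at (i,½,½),
-- (½,j,½), (½,½,k).  The bottom vertex is O O O, the top vertex is I I I.
record Cube (V F : Set) : Set where
  field
    vertex            : Bool → Bool → Bool → V
    face₁ face₂ face₃ : Bool → F

mapCube : {V V′ F F′ : Set} → (V → V′) → (F → F′) → Cube V F → Cube V′ F′
mapCube g h C = record
  { vertex = λ i j k → g (vertex i j k)
  ; face₁  = λ i → h (face₁ i)
  ; face₂  = λ i → h (face₂ i)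
  ; face₃  = λ i → h (face₃ i)
  }
  where open Cube C

record Complex : Set where
  field
    #⁰ #² #³ : ℕ
    corners  : Fin #² → Quad (Fin #⁰)
    cube     : Fin #³ → Cube (Fin #⁰) (Fin #²)

  -- A corner of a 3-cube: the cube, and one of its vertices in coordinates.
  Corner : Set
  Corner = Fin #³ × Bool × Bool × Bool

  cornerVertex : Corner → Fin #⁰
  cornerVertex (C , i , j , k) = Cube.vertex (cube C) i j k

  -- The three 2-faces of the cube that contain the given vertex.
  cornerFaces : Corner → List (Fin #²)
  cornerFaces (C , i , j , k) = face₁ i ∷ face₂ j ∷ face₃ k ∷ []
    where open Cube (cube C)

  -- As the eight vertices of a cube are distinct, the corners at v
  -- enumerate, without repetition, the 3-cubes containing v.
  cornersAt : Fin #⁰ → List Corner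
  cornersAt v = filter (λ c → cornerVertex c ≟ v)
    (cartesianProduct (allFin #³)
      (cartesianProduct (O ∷ I ∷ []) (cartesianProduct (O ∷ I ∷ []) (O ∷ I ∷ []))))

  facesAt : Fin #⁰ → List (Fin #²)
  facesAt v = filter (λ S → v ∈? toList (corners S)) (allFin #²)

  Edge : Fin #² → Fin #⁰ → Fin #⁰ → Set
  Edge S = Side (toList (corners S))

  edge? : (S : Fin #²) (a b : Fin #⁰) → Dec (Edge S a b)
  edge? S = side? (toList (corners S))

  neighbours : Fin #⁰ → List (Fin #⁰)
  neighbours v = filter (λ a → any? (λ S → edge? S v a)) (allFin #⁰)

  Adjacent : Fin #⁰ → Fin #² → Fin #² → Set
  Adjacent v S S′ = ∃[ c ] (c ∈ cornersAt v × S ∈ cornerFaces c × S′ ∈ cornerFaces c)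

  -- v has a neighbourhood homeomorphic to an open ball in ℝ³.  Small
  -- neighbourhoods of v are open cones over the link of v, whose vertices,
  -- edges and triangles are the edges, 2-faces and 3-cubes at v; such a cone is
  -- an open ball exactly when the link is a 2-sphere, i.e. a closed connected
  -- surface (the first three fields) of Euler characteristic 2.
  record Interior (v : Fin #⁰) : Set where
    field
      two-cubes         : ∀ S → S ∈ facesAt v →
                          length (filter (λ c → S ∈? cornerFaces c) (cornersAt v)) ≡ 2
      locally-connected : ∀ a S S′ → Edge S v a → Edge S′ v a →
                          EqClosure (λ P P′ → Edge P v a × Edge P′ v a × Adjacent v P P′) S S′
      connected         : ∀ S S′ → S ∈ facesAt v → S′ ∈ facesAt v → EqClosure (Adjacent v) S S′
      euler             : length (neighbours v) +ℕ length (cornersAt v) ≡ length (facesAt v) +ℕ 2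

  data Opposite : Fin #² → Fin #² → Set where
    opposite₁ : ∀ C → Opposite (Cube.face₁ (cube C) O) (Cube.face₁ (cube C) I)
    opposite₂ : ∀ C → Opposite (Cube.face₂ (cube C) O) (Cube.face₂ (cube C) I)
    opposite₃ : ∀ C → Opposite (Cube.face₃ (cube C) O) (Cube.face₃ (cube C) I)

  infix 4 _∼_
  _∼_ : Fin #² → Fin #² → Set
  _∼_ = EqClosure Opposite

  -- {-1,1}^(ϰ²/∼), as the ∼-invariant functions on ϰ².
  ClassSigns : Set
  ClassSigns = Σ[ t ∈ (Fin #² → Sign) ] (∀ {S S′} → S ∼ S′ → t S ≡ t S′)

  ψ : ClassSigns → Fin #³ → Sign
  ψ (t , _) C = t (face₁ O) *ₛ t (face₂ O) *ₛ t (face₃ O)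
    where open Cube (cube C)

  Comfortable : Set
  Comfortable = ∀ (u : Fin #³ → Sign) →
    (∀ v → Interior v → foldr _*ₛ_ 1ₛ (map (λ c → u (proj₁ c)) (cornersAt v)) ≡ 1ₛ) →
    ∃[ t ] (∀ C → ψ t C ≡ u C)

-- A complex together with the cells carrying the labels of the quadrangulation
-- that currently forms its top.
record Stage (n m : ℕ) : Set where
  field
    complex : Complex
  open Complex complex public
  field
    vertexOf : Fin n → Fin #⁰
    faceOf   : Fin m → Fin #²

initial : {R : Polygon n} → Quadrangulation R m → Stage n m
initial {n} {m} T = record
  { complex  = record
    { #⁰ = n ; #² = m ; #³ = 0
    ; corners = Quadrangulation.corners T
    ; cube    = λ ()
    }
  ; vertexOf = λ a → a
  ; faceOf   = λ f → f
  }

-- The new vertex is 0; the new 2-faces 0, 1, 2 carry the labels t₁, t₂, t₃;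
-- the new 3-cube is 0.  Old cells are shifted.
module _ {R : Polygon n} {T T′ : Quadrangulation R m} (𝐒 : Stage n m) (φ : Flip T T′) where
  open Stage 𝐒
  open Flip φ

  vertexOf′ : Fin n → Fin (1 +ℕ #⁰)
  vertexOf′ a = if does (a ≟ w) then zero else suc (vertexOf a)

  faceOf′ : Fin m → Fin (3 +ℕ #²)
  faceOf′ f = if does (f ≟ t₁) then 0F else
              if does (f ≟ t₂) then 1F else
              if does (f ≟ t₃) then 2F else
              3 ↑ʳ faceOf f

  corners′ : Fin (3 +ℕ #²) → Quad (Fin (1 +ℕ #⁰))
  corners′ 0F                  = Vec.map vertexOf′ (Quadrangulation.corners T′ t₁)
  corners′ 1F                  = Vec.map vertexOf′ (Quadrangulation.corners T′ t₂)
  corners′ 2F                  = Vec.map vertexOf′ (Quadrangulation.corners T′ t₃)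
  corners′ (suc (suc (suc S))) = Vec.map suc (corners S)

  newVertex : Bool → Bool → Bool → Fin (1 +ℕ #⁰)
  newVertex O O O = suc (vertexOf w)
  newVertex I O O = suc (vertexOf e₁)
  newVertex O I O = suc (vertexOf e₂)
  newVertex O O I = suc (vertexOf e₃)
  newVertex I I O = suc (vertexOf e₁₂)
  newVertex I O I = suc (vertexOf e₁₃)
  newVertex O I I = suc (vertexOf e₂₃)
  newVertex I I I = zero

  newCube : Cube (Fin (1 +ℕ #⁰)) (Fin (3 +ℕ #²))
  newCube = record
    { vertex = newVertex
    ; face₁  = λ i → if i then 0F else 3 ↑ʳ faceOf t₁
    ; face₂  = λ i → if i then 1F else 3 ↑ʳ faceOf t₂
    ; face₃  = λ i → if i then 2F else 3 ↑ʳ faceOf t₃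
    }

  cube′ : Fin (1 +ℕ #³) → Cube (Fin (1 +ℕ #⁰)) (Fin (3 +ℕ #²))
  cube′ zero    = newCube
  cube′ (suc C) = mapCube suc (3 ↑ʳ_) (cube C)

  attach : Stage n m
  attach = record
    { complex  = record
      { #⁰ = 1 +ℕ #⁰ ; #² = 3 +ℕ #² ; #³ = 1 +ℕ #³
      ; corners = corners′
      ; cube    = cube′
      }
    ; vertexOf = vertexOf′
    ; faceOf   = faceOf′
    }

stage : {R : Polygon n} {T : Quadrangulation R m} → Pile T → Stage n m
stage ⟨ T ⟩   = initial T
stage (𝐓 ▷ φ) = attach (stage 𝐓) φ

ϰ : {R : Polygon n} {T : Quadrangulation R m} → Pile T → Complex
ϰ 𝐓 = Stage.complex (stage 𝐓)

-- The field of values.  ℂ is the intended instance.  Apartness _#_ plays the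
-- role of ≠; for a field with decidable equality it is the negation of _≈_.
record ScalarField c ℓ₁ ℓ₂ : Set (lsuc (c ⊔ ℓ₁ ⊔ ℓ₂)) where
  field
    heytingField : HeytingField c ℓ₁ ℓ₂
  open HeytingField heytingField public renaming (_+_ to infixl 6 _+_; _*_ to infixl 7 _*_; _-_ to infixl 6 _-_)

  2# : Carrier
  2# = 1# + 1#

  field
    2#0  : 2# # 0#
    sqrt : ∀ a → a # 0# → ∃[ b ] b * b ≈ a

  -- #⇒invertible inverts y - 0#.
  infixl 7 _/_⟨_⟩
  _/_⟨_⟩ : Carrier → (y : Carrier) → y # 0# → Carrier
  x / y ⟨ y#0 ⟩ = x * proj₁ (#⇒invertible y#0)

  infix 9 _²
  _² : Carrier → Carrier
  x ² = x * x

module _ {c ℓ₁ ℓ₂ : Level} (𝔽 : ScalarField c ℓ₁ ℓ₂) where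
  open ScalarField 𝔽

  4# : Carrier
  4# = 2# * 2#

  ∏ : {A : Set} → List A → (A → Carrier) → Carrier
  ∏ as f = foldr _*_ 1# (map f as)

  -- x_{v₁} x_{v₃} + x_{v₂} x_{v₄}; this does not depend on which vertex of the
  -- quadrilateral is listed first.
  diagonals : {V : Set} → (V → Carrier) → Quad V → Carrier
  diagonals x (v₁ ∷ v₂ ∷ v₃ ∷ v₄ ∷ []) = x v₁ * x v₃ + x v₂ * x v₄

  kashaev : (Bool → Bool → Bool → Carrier) → Carrier
  kashaev z = 2# * (a ² + b ² + c′ ² + d ²) - (a + b + c′ + d) ² - 4# * (s + t)
    where
    a  = z O O O * z I I I
    b  = z I O O * z O I I
    c′ = z O I O * z I O I
    d  = z O O I * z I I O
    s  = z O O O * z O I I * z I O I * z I I O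
    t  = z I I I * z I O O * z O I O * z O O I

  kashaev₀₀₀ : (Bool → Bool → Bool → Carrier) → Carrier
  kashaev₀₀₀ z =
    (z I I I * z O O O ² - z O O O * (z I O O * z O I I + z O I O * z I O I + z O O I * z I I O)) / 2# ⟨ 2#0 ⟩
      - z I O O * z O I O * z O O I

  record KHexahedronCube (z : Bool → Bool → Bool → Carrier) (z₀₀₀#0 : z O O O # 0#)
                         (f₁ f₂ f₃ : Bool → Carrier) : Set ℓ₁ where
    A : Carrier
    A = 2# * z I O O * z O I O * z O O I
      + z O O O * (z I O O * z O I I + z O I O * z I O I + z O O I * z I I O)
    field
      eq₁   : f₁ I ≈ (f₂ O * f₃ O + f₁ O * z I O O) / z O O O ⟨ z₀₀₀#0 ⟩
      eq₂   : f₂ I ≈ (f₁ O * f₃ O + f₂ O * z O I O) / z O O O ⟨ z₀₀₀#0 ⟩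
      eq₃   : f₃ I ≈ (f₁ O * f₂ O + f₃ O * z O O I) / z O O O ⟨ z₀₀₀#0 ⟩
      eq₁₁₁ : z I I I ≈ (A + 2# * f₁ O * f₂ O * f₃ O) / z O O O ⟨ z₀₀₀#0 ⟩ / z O O O ⟨ z₀₀₀#0 ⟩

  module _ (K : Complex) where
    open Complex K

    KashaevAt : (Fin #⁰ → Carrier) → Fin #³ → Carrier
    KashaevAt x C = kashaev (λ i j k → x (Cube.vertex (cube C) i j k))

    -- K^C_v: the reflection moving v to the origin is applied to C.
    KashaevAtCorner : (Fin #⁰ → Carrier) → Corner → Carrier
    KashaevAtCorner x (C , i , j , k) =
      kashaev₀₀₀ (λ i′ j′ k′ → x (Cube.vertex (cube C) (i xor i′) (j xor j′) (k xor k′)))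

    record CoherentSolution (x : Fin #⁰ → Carrier) : Set ℓ₁ where
      field
        solution : ∀ C → KashaevAt x C ≈ 0#
        coherent : ∀ v → Interior v →
                   ∏ (cornersAt v) (KashaevAtCorner x) ≈ ∏ (facesAt v) (λ S → diagonals x (corners S))

    record KHexahedron (x̃ : Fin #⁰ ⊎ Fin #² → Carrier) : Set (ℓ₁ ⊔ ℓ₂) where
      field
        nonzero  : ∀ v → x̃ (inj₁ v) # 0#
        face-eq  : ∀ S → x̃ (inj₂ S) ² ≈ diagonals (λ v → x̃ (inj₁ v)) (corners S)
        cube-eqs : ∀ C → let open Cube (cube C) in
          KHexahedronCube (λ i j k → x̃ (inj₁ (vertex i j k))) (nonzero (vertex O O O))
            (λ i → x̃ (inj₂ (face₁ i))) (λ j → x̃ (inj₂ (face₂ j))) (λ k → x̃ (inj₂ (face₃ k)))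

{-# OPTIONS --safe #-}

-- On a cube of a K-hexahedron solution K^C_v = f₁f₂f₃ at the bottom vertex v, and
-- K^C = 0 determines K^C_v up to sign.  So, going up the pile, square roots f_S of
-- the face quantities and signs u_C can be chosen such that the equations of the
-- cube C hold once f is multiplied by u_C on the two faces centred at (i,½,½).
-- Then K^C_v = ε u_C ∏_{S ∋ v} (- f_S) at every vertex v of C, where ε = -1 if v is
-- the bottom or the top of C and ε = 1 otherwise.  If v is interior, then each face
-- at v lies in two cubes, and v is the top of one cube and the bottom of one cube, so
-- ∏_{C ∋ v} K^C_v = (∏ u_C) ∏ f_S², and coherence gives ∏_{C ∋ v} u_C = 1.  As ϰ is
-- comfortable, u = ψ(t) for signs t on the classes of faces, and t_S f_S is the
-- required extension.
module Submission where

open import Defs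
open import Algebra.Apartness.Bundles using (HeytingCommutativeRing)
open import Algebra.Bundles using (CommutativeRing)
open import Algebra.Solver.Ring.AlmostCommutativeRing using (fromCommutativeRing; _-Raw-AlmostCommutative⟶_)
open import Data.Bool as Bool using (Bool; true; false; if_then_else_; _xor_)
open import Data.Empty using (⊥; ⊥-elim)
open import Data.Fin using (Fin; zero; suc; _↑ʳ_; _≟_)
open import Data.Fin.Patterns using (0F; 1F; 2F; 3F; 4F; 5F; 6F; 7F)
open import Data.Fin.Properties using (any?; suc-injective)
open import Data.Integer as ℤ using (ℤ; +_; -[1+_]; _⊖_)
open import Data.List using (List; []; _∷_; _++_; map; foldr; filter; length; allFin; tabulate; cartesianProduct)
open import Data.List.Membership.Propositional using (_∈_; _∉_)
open import Data.List.Membership.Propositional.Properties using (∈-map⁺; ∈-filter⁺; ∈-filter⁻; ∈-allFin)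
open import Data.List.Membership.Propositional.Properties.WithK using (unique∧set⇒bag)
open import Data.List.Relation.Binary.BagAndSetEquality using (∼bag⇒↭)
open import Data.List.Relation.Binary.Permutation.Propositional as ↭ using (_↭_)
open import Data.List.Relation.Unary.All as All using (All; []; _∷_)
open import Data.List.Relation.Unary.AllPairs using ([]; _∷_)
open import Data.List.Relation.Unary.Any using (here; there)
open import Data.List.Relation.Unary.Unique.Propositional using (Unique)
open import Data.Maybe using (Maybe; just; nothing; is-just)
open import Data.Nat as ℕ using (ℕ; _≤_; z≤n; s≤s)
open import Data.Product using (Σ-syntax; ∃-syntax; _×_; _,_; proj₁; proj₂)
open import Data.Sign using (Sign) renaming (+ to 1ₛ; - to -1ₛ; _*_ to _*ₛ_)
open import Data.Sum using (_⊎_; inj₁; inj₂; [_,_])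
open import Data.Unit using (⊤; tt)
open import Data.Vec as Vec using (Vec; []; _∷_; toList)
open import Function using (_∘_; id; mk⇔)
open import Function.Definitions using (Injective)
open import Level using (0ℓ; _⊔_)
open import Relation.Binary.PropositionalEquality as ≡ using (_≡_; _≢_; module ≡-Reasoning)
open import Relation.Nullary using (¬_; Dec; does; yes; no)
open import Relation.Nullary.Decidable using (dec-true; dec-false)
open import Relation.Unary using (Pred; Decidable)
import Algebra.Apartness.Properties.HeytingCommutativeRing
import Algebra.Properties.AbelianGroup
import Algebra.Properties.Ring
import Algebra.Properties.Semiring.Exp
import Algebra.Properties.Semiring.Mult.TCOptimised
import Algebra.Solver.Ring
import Data.Integer.Properties as ℤ
import Data.List.Properties as List
import Data.List.Relation.Unary.Unique.Propositional.Properties as Unique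
import Data.Nat.Properties as ℕ
import Data.Sign.Properties as Sign
import Data.Vec.Properties as Vec
import Relation.Binary.Construct.Closure.Equivalence as EqClosure
import Relation.Binary.Reasoning.Setoid

-- The sign ambiguity comes from completing a square. As a polynomial in the top value, `K^C` is
-- quadratic with leading coefficient `z O O O ²`, derivative `4 K^C_v` and discriminant
-- `16 D₁ D₂ D₃`, where `v` is the bottom vertex and `Dᵢ` are the quantities of the three faces at
-- `v`. So `K^C = 0` makes `K^C_v` a square root of `D₁ D₂ D₃`, and `f₁ f₂ f₃` is another. The
-- obstacle is that faces are shared: a wrong sign at a cube cannot be repaired by changing a root
-- on one of its bottom faces, which may already occur in the equations of a cube below. Hence the
-- defect is recorded per cube, and all defects are repaired at once at the end. The factors are
-- `- f_S` rather than `f_S` for the sake of parity: up to `u_C`, `K^C_v` is `f₁ f₂ f₃` at the two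
-- poles and `- f₁ f₂ f₃` at the six other vertices. With the minus signs moved to the faces, where
-- they square away, only the poles leave a sign, and the number of cubes around `v` does not
-- matter.

-- A ring solver with integer coefficients.

module IntegerRingSolver {c ℓ} (R : CommutativeRing c ℓ) where
  open import Data.Nat using (zero; suc)
  open CommutativeRing R hiding (zero)
  open Algebra.Properties.Ring ring using (-0#≈0#; -‿distribˡ-*; -‿distribʳ-*; -‿involutive)
  open Algebra.Properties.AbelianGroup +-abelianGroup using (⁻¹-∙-comm)
  open Algebra.Properties.Semiring.Mult.TCOptimised semiring using (×1-homo-*; ×-homo-+; 1+×) renaming (_×_ to _·_)
  open Relation.Binary.Reasoning.Setoid setoid

  -- With the optimised multiples, `+ 1`, `+ 2` and `-[1+ 0 ]` go definitionally to `1#`, `1# + 1#`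
  -- and `- 1#`, so constants of solver polynomials evaluate to the constants used in the
  -- definitions.
  fromℤ : ℤ → Carrier
  fromℤ (+ n)    = n · 1#
  fromℤ -[1+ n ] = - (suc n · 1#)

  fromℤ-⊖ : ∀ m n → fromℤ (m ⊖ n) ≈ m · 1# - n · 1#
  fromℤ-⊖ m zero = begin
    m · 1#          ≈⟨ +-identityʳ _ ⟨
    m · 1# + 0#     ≈⟨ +-congˡ -0#≈0# ⟨
    m · 1# - 0#     ∎
  fromℤ-⊖ zero (suc n) = sym (+-identityˡ _)
  fromℤ-⊖ (suc m) (suc n) = begin
    fromℤ (suc m ⊖ suc n)             ≡⟨ ≡.cong fromℤ (ℤ.[1+m]⊖[1+n]≡m⊖n m n) ⟩
    fromℤ (m ⊖ n)                     ≈⟨ fromℤ-⊖ m n ⟩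
    m · 1# - n · 1#                   ≈⟨ +-congʳ (+-identityˡ _) ⟨
    0# + m · 1# - n · 1#              ≈⟨ +-congʳ (+-congʳ (-‿inverseʳ 1#)) ⟨
    1# - 1# + m · 1# - n · 1#         ≈⟨ +-congʳ (+-assoc _ _ _) ⟩
    1# + (- 1# + m · 1#) - n · 1#     ≈⟨ +-congʳ (+-congˡ (+-comm _ _)) ⟩
    1# + (m · 1# - 1#) - n · 1#       ≈⟨ +-congʳ (+-assoc _ _ _) ⟨
    1# + m · 1# - 1# - n · 1#         ≈⟨ +-assoc _ _ _ ⟩
    1# + m · 1# + (- 1# - n · 1#)     ≈⟨ +-congˡ (⁻¹-∙-comm _ _) ⟩
    (1# + m · 1#) - (1# + n · 1#)     ≈⟨ +-cong (1+× m 1#) (-‿cong (1+× n 1#)) ⟨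
    suc m · 1# - suc n · 1#           ∎

  fromℤ-+ : ∀ i j → fromℤ (i ℤ.+ j) ≈ fromℤ i + fromℤ j
  fromℤ-+ (+ m) (+ n)         = ×-homo-+ 1# m n
  fromℤ-+ (+ m) -[1+ n ]      = fromℤ-⊖ m (suc n)
  fromℤ-+ -[1+ m ] (+ n)      = trans (fromℤ-⊖ n (suc m)) (+-comm _ _)
  fromℤ-+ -[1+ m ] -[1+ n ]   = begin
    - (suc (suc (m ℕ.+ n)) · 1#)       ≡⟨ ≡.cong (λ k → - (k · 1#)) (≡.cong suc (≡.sym (ℕ.+-suc m n))) ⟩
    - ((suc m ℕ.+ suc n) · 1#)         ≈⟨ -‿cong (×-homo-+ 1# (suc m) (suc n)) ⟩
    - (suc m · 1# + suc n · 1#)        ≈⟨ ⁻¹-∙-comm _ _ ⟨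
    - (suc m · 1#) - suc n · 1#        ∎

  fromℤ-neg : ∀ i → fromℤ (ℤ.- i) ≈ - fromℤ i
  fromℤ-neg (+ zero)  = sym -0#≈0#
  fromℤ-neg (+ suc n) = refl
  fromℤ-neg -[1+ n ]  = sym (-‿involutive _)

  fromℤ-*-+ : ∀ m j → fromℤ (+ m ℤ.* j) ≈ m · 1# * fromℤ j
  fromℤ-*-+ m (+ n) = trans (reflexive (≡.cong fromℤ (≡.sym (ℤ.pos-* m n)))) (×1-homo-* m n)
  fromℤ-*-+ m -[1+ n ] = begin
    fromℤ (+ m ℤ.* -[1+ n ])        ≡⟨ ≡.cong fromℤ (ℤ.neg-distribʳ-* (+ m) (+ suc n)) ⟨
    fromℤ (ℤ.- (+ m ℤ.* + suc n))   ≈⟨ fromℤ-neg (+ m ℤ.* + suc n) ⟩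
    - fromℤ (+ m ℤ.* + suc n)       ≈⟨ -‿cong (fromℤ-*-+ m (+ suc n)) ⟩
    - (m · 1# * (suc n · 1#))       ≈⟨ -‿distribʳ-* _ _ ⟩
    m · 1# * - (suc n · 1#)         ∎

  fromℤ-* : ∀ i j → fromℤ (i ℤ.* j) ≈ fromℤ i * fromℤ j
  fromℤ-* (+ m)    j = fromℤ-*-+ m j
  fromℤ-* -[1+ m ] j = begin
    fromℤ (-[1+ m ] ℤ.* j)          ≡⟨ ≡.cong fromℤ (ℤ.neg-distribˡ-* (+ suc m) j) ⟨
    fromℤ (ℤ.- (+ suc m ℤ.* j))     ≈⟨ fromℤ-neg (+ suc m ℤ.* j) ⟩
    - fromℤ (+ suc m ℤ.* j)         ≈⟨ -‿cong (fromℤ-*-+ (suc m) j) ⟩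
    - (suc m · 1# * fromℤ j)        ≈⟨ -‿distribˡ-* _ _ ⟩
    - (suc m · 1#) * fromℤ j        ∎

  morphism : ℤ.+-*-rawRing -Raw-AlmostCommutative⟶ fromCommutativeRing R
  morphism = record
    { ⟦_⟧    = fromℤ
    ; +-homo = fromℤ-+
    ; *-homo = fromℤ-*
    ; -‿homo = fromℤ-neg
    ; 0-homo = refl
    ; 1-homo = refl
    }

  fromℤ-≟ : ∀ i j → Maybe (fromℤ i ≈ fromℤ j)
  fromℤ-≟ i j with i ℤ.≟ j
  ... | yes i≡j = just (reflexive (≡.cong fromℤ i≡j))
  ... | no  _   = nothing

  open Algebra.Solver.Ring ℤ.+-*-rawRing (fromCommutativeRing R) morphism fromℤ-≟ public
    using (Polynomial; con; var; _:+_; _:*_; _:-_; :-_; ⟦_⟧; normalise; _≟N_; ⟦_⟧N-cong; correct)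

  -- Deciding equality of normal forms is much faster than comparing their values by conversion.
  identity : ∀ {n} (p q : Polynomial n) → Bool.T (is-just (normalise p ≟N normalise q)) →
             ∀ ρ → ⟦ p ⟧ ρ ≈ ⟦ q ⟧ ρ
  identity p q ok ρ with normalise p ≟N normalise q
  ... | just p≈q = trans (sym (correct p ρ)) (trans (⟦ p≈q ⟧N-cong ρ) (correct q ρ))

-- Algebra of a single cube.

poleSign : Bool → Bool → Bool → Sign
poleSign O O O = -1ₛ
poleSign I I I = -1ₛ
poleSign _ _ _ = 1ₛ

module Hexahedra {c ℓ₁ ℓ₂} (𝔽 : ScalarField c ℓ₁ ℓ₂) where
  open ScalarField 𝔽
  open HeytingCommutativeRing heytingCommutativeRing using (commutativeRing)
  open Algebra.Apartness.Properties.HeytingCommutativeRing heytingCommutativeRing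
  open IntegerRingSolver commutativeRing
  open Relation.Binary.Reasoning.Setoid setoid

  private
    :2 : ∀ {n} → Polynomial n
    :2 = con (+ 2)

    Values : Set c
    Values = Bool → Bool → Bool → Carrier

  σ : Sign → Carrier
  σ 1ₛ  = 1#
  σ -1ₛ = - 1#

  σ-homo : ∀ s t → σ (s *ₛ t) ≈ σ s * σ t
  σ-homo 1ₛ  t   = sym (*-identityˡ _)
  σ-homo -1ₛ 1ₛ  = sym (*-identityʳ _)
  σ-homo -1ₛ -1ₛ = identity (con (+ 1)) (con -[1+ 0 ] :* con -[1+ 0 ]) _ []

  σ-square : ∀ s → σ s * σ s ≈ 1#
  σ-square 1ₛ  = *-identityˡ _
  σ-square -1ₛ = identity (con -[1+ 0 ] :* con -[1+ 0 ]) (con (+ 1)) _ []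

  σ-involutive : ∀ s x → σ s * (σ s * x) ≈ x
  σ-involutive s x = trans (sym (*-assoc _ _ _)) (trans (*-congʳ (σ-square s)) (*-identityˡ x))

  σ-square-* : ∀ s x → (σ s * x) ² ≈ x ²
  σ-square-* s x = begin
    σ s * x * (σ s * x)     ≈⟨ identity (S :* X :* (S :* X)) (S :* S :* (X :* X)) _ (σ s ∷ x ∷ []) ⟩
    σ s * σ s * (x * x)     ≈⟨ *-congʳ (σ-square s) ⟩
    1# * (x * x)            ≈⟨ *-identityˡ _ ⟩
    x * x                   ∎
    where
    S = var {2} 0F
    X = var {2} 1F

  module _ {a : Carrier} (a#0 : a # 0#) where
    inverse : Carrier
    inverse = proj₁ (#⇒invertible a#0)

    inverseʳ : a * inverse ≈ 1#
    inverseʳ = trans (*-congʳ (sym (x-0≈x a))) (proj₂ (proj₂ (#⇒invertible a#0)))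

    *-cancelˡ : ∀ {x y} → a * x ≈ a * y → x ≈ y
    *-cancelˡ {x} {y} ax≈ay = begin
      x                    ≈⟨ *-identityˡ x ⟨
      1# * x               ≈⟨ *-congʳ inverseʳ ⟨
      a * inverse * x      ≈⟨ identity (A :* R :* X) (R :* (A :* X)) _ (a ∷ inverse ∷ x ∷ []) ⟩
      inverse * (a * x)    ≈⟨ *-congˡ ax≈ay ⟩
      inverse * (a * y)    ≈⟨ identity (R :* (A :* X)) (A :* R :* X) _ (a ∷ inverse ∷ y ∷ []) ⟩
      a * inverse * y      ≈⟨ *-congʳ inverseʳ ⟩
      1# * y               ≈⟨ *-identityˡ y ⟩
      y                    ∎
      where
      A = var {3} 0F
      R = var {3} 1F
      X = var {3} 2F

    divide : ∀ x → a * (x * inverse) ≈ x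
    divide x = begin
      a * (x * inverse)   ≈⟨ identity (A :* (X :* R)) (A :* R :* X) _ (a ∷ inverse ∷ x ∷ []) ⟩
      a * inverse * x     ≈⟨ *-congʳ inverseʳ ⟩
      1# * x              ≈⟨ *-identityˡ x ⟩
      x                   ∎
      where
      A = var {3} 0F
      R = var {3} 1F
      X = var {3} 2F

    quotient : ∀ {x y} → a * x ≈ y → x ≈ y / a ⟨ a#0 ⟩
    quotient {x} {y} ax≈y = *-cancelˡ (trans ax≈y (sym (divide y)))

  -- Apartness from zero amounts to invertibility, and `x` divided by `y` is an inverse of `x`.
  factor#0 : ∀ {x y} → x * x ≈ y → y # 0# → x # 0#
  factor#0 {x} {y} xx≈y y#0 = invertibleʳ⇒# (x * inverse y#0 , (begin
    (x - 0#) * (x * inverse y#0)   ≈⟨ *-congʳ (x-0≈x x) ⟩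
    x * (x * inverse y#0)          ≈⟨ *-assoc _ _ _ ⟨
    x * x * inverse y#0            ≈⟨ *-congʳ xx≈y ⟩
    y * inverse y#0                ≈⟨ inverseʳ y#0 ⟩
    1#                             ∎))

  x#y⇒x-y#0 : ∀ {x y} → x # y → x - y # 0#
  x#y⇒x-y#0 x#y = invertibleʳ⇒# (inverse′ , trans (*-congʳ (x-0≈x _)) (proj₂ (proj₂ (#⇒invertible x#y))))
    where inverse′ = proj₁ (#⇒invertible x#y)

  x-y≈0⇒x≈y : ∀ {x y} → x - y ≈ 0# → x ≈ y
  x-y≈0⇒x≈y {x} {y} eq = begin
    x          ≈⟨ identity X (X :- Y :+ Y) _ (x ∷ y ∷ []) ⟩
    x - y + y  ≈⟨ +-congʳ eq ⟩
    0# + y     ≈⟨ +-identityˡ y ⟩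
    y          ∎
    where
    X = var {2} 0F
    Y = var {2} 1F

  -- The product `(x + y) * (x - y)` vanishes, but without decidable equality it cannot be asked
  -- which factor does. Cotransitivity compares `x + y` with the points `2# * y` and `0#`, which are
  -- apart: apartness from `0#` cancels the first factor and gives `x ≈ y`; apartness from `2# * y`
  -- makes `x - y` invertible and gives `x ≈ - y`.
  equal-squares : ∀ {x y} → y # 0# → x * x ≈ y * y → ∃[ s ] x ≈ σ s * y
  equal-squares {x} {y} y#0 xx≈yy = decide (#-cotrans (x#0y#0→xy#0 2#0 y#0) (x + y))
    where
    X = var {2} 0F
    Y = var {2} 1F

    factored : (x + y) * (x - y) ≈ 0#
    factored = begin
      (x + y) * (x - y)   ≈⟨ identity ((X :+ Y) :* (X :- Y)) (X :* X :- Y :* Y) _ (x ∷ y ∷ []) ⟩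
      x * x - y * y       ≈⟨ +-congʳ xx≈yy ⟩
      y * y - y * y       ≈⟨ -‿inverseʳ _ ⟩
      0#                  ∎

    decide : 2# * y # x + y ⊎ x + y # 0# → ∃[ s ] x ≈ σ s * y
    decide (inj₁ 2y#x+y) = -1ₛ , x-y≈0⇒x≈y (*-cancelˡ (x#y⇒x-y#0 2y#x+y) (begin
      (2# * y - (x + y)) * (x - - 1# * y)
        ≈⟨ identity ((:2 :* Y :- (X :+ Y)) :* (X :- con -[1+ 0 ] :* Y))
             (con -[1+ 0 ] :* ((X :+ Y) :* (X :- Y))) _ (x ∷ y ∷ []) ⟩
      - 1# * ((x + y) * (x - y))      ≈⟨ *-congˡ factored ⟩
      - 1# * 0#                       ≈⟨ zeroʳ _ ⟩
      0#                              ≈⟨ zeroʳ _ ⟨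
      (2# * y - (x + y)) * 0#         ∎))
    decide (inj₂ x+y#0) = 1ₛ , x-y≈0⇒x≈y (*-cancelˡ x+y#0 (begin
      (x + y) * (x - 1# * y)   ≈⟨ *-congˡ (+-congˡ (-‿cong (*-identityˡ y))) ⟩
      (x + y) * (x - y)        ≈⟨ factored ⟩
      0#                       ≈⟨ zeroʳ _ ⟨
      (x + y) * 0#             ∎))

  -- A leading colon marks solver syntax. `:discriminant` stands for `2 K^C_v` at the vertex
  -- `O O O`, which is half the derivative of `K^C` in `z I I I`.
  :kashaev :numerator :discriminant : ∀ {n} → (Bool → Bool → Bool → Polynomial n) → Polynomial n
  :kashaev z = :2 :* (a :* a :+ b :* b :+ c′ :* c′ :+ d :* d) :- S :* S :- :2 :* :2 :* (s :+ t)
    where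
    a  = z O O O :* z I I I
    b  = z I O O :* z O I I
    c′ = z O I O :* z I O I
    d  = z O O I :* z I I O
    S  = a :+ b :+ c′ :+ d
    s  = z O O O :* z O I I :* z I O I :* z I I O
    t  = z I I I :* z I O O :* z O I O :* z O O I
  :numerator z =
    z I I I :* (z O O O :* z O O O) :- z O O O :* (z I O O :* z O I I :+ z O I O :* z I O I :+ z O O I :* z I I O)
  :discriminant z = :numerator z :- :2 :* z I O O :* z O I O :* z O O I

  module _ (z : Values) where
    numerator : Carrier
    numerator = z I I I * z O O O ² - z O O O * (z I O O * z O I I + z O I O * z I O I + z O O I * z I I O)

    -- This is `A` of `KHexahedronCube`.
    bottom : Carrier
    bottom = 2# * z I O O * z O I O * z O O I + z O O O * (z I O O * z O I I + z O I O * z I O I + z O O I * z I I O)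

    private
      :z : Bool → Bool → Bool → Polynomial 8
      :z O O O = var 0F
      :z I O O = var 1F
      :z O I O = var 2F
      :z O O I = var 3F
      :z O I I = var 4F
      :z I O I = var 5F
      :z I I O = var 6F
      :z I I I = var 7F

      ρ : Vec Carrier 8
      ρ = z O O O ∷ z I O O ∷ z O I O ∷ z O O I ∷ z O I I ∷ z I O I ∷ z I I O ∷ z I I I ∷ []

    -- 4 (K^C_v)² = 4 D₁ D₂ D₃ + z_v² K^C at v = 000.
    discriminant-square :
      (numerator - 2# * z I O O * z O I O * z O O I) * (numerator - 2# * z I O O * z O I O * z O O I) ≈
      4# 𝔽 * ((z O O O * z O I I + z O I O * z O O I) * (z O O O * z I O I + z I O O * z O O I)
                * (z O O O * z I I O + z I O O * z O I O))
        + z O O O ² * kashaev 𝔽 z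
    discriminant-square = identity (:discriminant :z :* :discriminant :z)
      (:2 :* :2 :* ((:z O O O :* :z O I I :+ :z O I O :* :z O O I) :* (:z O O O :* :z I O I :+ :z I O O :* :z O O I)
         :* (:z O O O :* :z I I O :+ :z I O O :* :z O I O))
        :+ :z O O O :* :z O O O :* :kashaev :z) _ ρ

    -- The term added to `bottom` is `2 K^C_v`, so the equation for `z I I I` says exactly that
    -- `K^C_v = f₁ f₂ f₃` at the bottom vertex. The other three equations can be taken as
    -- definitions of the upper faces, so this is the only one that can fail by a sign.
    eq₁₁₁-residue : z O O O * (z O O O * z I I I) ≈
      bottom + (numerator - 2# * z I O O * z O I O * z O O I)
    eq₁₁₁-residue = identity (:z O O O :* (:z O O O :* :z I I I))
      (:2 :* :z I O O :* :z O I O :* :z O O I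
        :+ :z O O O :* (:z I O O :* :z O I I :+ :z O I O :* :z I O I :+ :z O O I :* :z I I O) :+ :discriminant :z) _ ρ

  -- The equations of KHexahedronCube without denominators; fᵢ and fᵢ′ belong to opposite faces.
  record Hexahedron (z : Values) (f₁ f₁′ f₂ f₂′ f₃ f₃′ : Carrier) : Set ℓ₁ where
    field
      square₁ : f₁ ² ≈ z O O O * z O I I + z O I O * z O O I
      square₂ : f₂ ² ≈ z O O O * z I O I + z I O O * z O O I
      square₃ : f₃ ² ≈ z O O O * z I I O + z I O O * z O I O
      eq₁     : z O O O * f₁′ ≈ f₂ * f₃ + f₁ * z I O O
      eq₂     : z O O O * f₂′ ≈ f₁ * f₃ + f₂ * z O I O
      eq₃     : z O O O * f₃′ ≈ f₁ * f₂ + f₃ * z O O I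
      eq₁₁₁   : z O O O * (z O O O * z I I I) ≈ bottom z + 2# * f₁ * f₂ * f₃

  module NewHexahedron (z : Values) (z₀#0 : z O O O # 0#) (K≈0 : kashaev 𝔽 z ≈ 0#)
    (f₁ f₂ f₃ : Carrier) (f₁#0 : f₁ # 0#) (f₂#0 : f₂ # 0#) (f₃#0 : f₃ # 0#)
    (square₁ : f₁ ² ≈ z O O O * z O I I + z O I O * z O O I)
    (square₂ : f₂ ² ≈ z O O O * z I O I + z I O O * z O O I)
    (square₃ : f₃ ² ≈ z O O O * z I I O + z I O O * z O I O) where

    private
      M P : Carrier
      M = numerator z - 2# * z I O O * z O I O * z O O I
      P = 2# * (f₁ * f₂ * f₃)

      M²≈P² : M * M ≈ P * P
      M²≈P² = begin
        M * M
          ≈⟨ discriminant-square z ⟩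
        4# 𝔽 * ((z O O O * z O I I + z O I O * z O O I) * (z O O O * z I O I + z I O O * z O O I)
          * (z O O O * z I I O + z I O O * z O I O)) + z O O O ² * kashaev 𝔽 z
          ≈⟨ +-cong (*-congˡ (*-cong (*-cong square₁ square₂) square₃)) (sym (trans (*-congˡ K≈0) (zeroʳ _))) ⟨
        4# 𝔽 * (f₁ ² * f₂ ² * f₃ ²) + 0#
          ≈⟨ +-identityʳ _ ⟩
        4# 𝔽 * (f₁ ² * f₂ ² * f₃ ²)
          ≈⟨ identity (:2 :* :2 :* (F :* F :* (G :* G) :* (H :* H))) (:2 :* (F :* G :* H) :* (:2 :* (F :* G :* H))) _
               (f₁ ∷ f₂ ∷ f₃ ∷ []) ⟩
        P * P ∎
        where
        F = var {3} 0F
        G = var {3} 1F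
        H = var {3} 2F

      signed : ∃[ s ] M ≈ σ s * P
      signed = equal-squares (x#0y#0→xy#0 2#0 (x#0y#0→xy#0 (x#0y#0→xy#0 f₁#0 f₂#0) f₃#0)) M²≈P²

    sign : Sign
    sign = proj₁ signed

    private
      e : Carrier
      e = σ sign * f₁

    -- The sign of a cube multiplies both faces of the first direction. The stored values are `f₁`
    -- and `opposite₁`, those in the equations are `σ sign` times these; hence the extra factor in
    -- `opposite₁`, which cancels in `hexahedron`.
    opposite₁ opposite₂ opposite₃ : Carrier
    opposite₁ = σ sign * ((f₂ * f₃ + e * z I O O) * inverse z₀#0)
    opposite₂ = (e * f₃ + f₂ * z O I O) * inverse z₀#0
    opposite₃ = (e * f₂ + f₃ * z O O I) * inverse z₀#0

    hexahedron : Hexahedron z e (σ sign * opposite₁) f₂ opposite₂ f₃ opposite₃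
    hexahedron = record
      { square₁ = trans (σ-square-* sign f₁) square₁
      ; square₂ = square₂
      ; square₃ = square₃
      ; eq₁     = trans (*-congˡ (σ-involutive sign _)) (divide z₀#0 _)
      ; eq₂     = divide z₀#0 _
      ; eq₃     = divide z₀#0 _
      ; eq₁₁₁   = trans (eq₁₁₁-residue z) (+-congˡ (trans (proj₂ signed)
          (identity (S :* (:2 :* (F :* G :* H))) (:2 :* (S :* F) :* G :* H) _ (σ sign ∷ f₁ ∷ f₂ ∷ f₃ ∷ []))))
      }
      where
      S = var {4} 0F
      F = var {4} 1F
      G = var {4} 2F
      H = var {4} 3F

  -- A hexahedron is determined by z₀₀₀ = a, zᵢ = a bᵢ and fᵢ = a gᵢ; up to the factor a, the other values are then
  -- polynomials in b and g, essentially the minors of the symmetric matrix with diagonal b and off-diagonal entries g.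
  module Parametrisation where
    private
      a  = var {7} 0F
      b₁ = var {7} 1F
      b₂ = var {7} 2F
      b₃ = var {7} 3F
      g₁ = var {7} 4F
      g₂ = var {7} 5F
      g₃ = var {7} 6F

    :z : Bool → Bool → Bool → Polynomial 7
    :z O O O = a
    :z I O O = a :* b₁
    :z O I O = a :* b₂
    :z O O I = a :* b₃
    :z O I I = a :* (g₁ :* g₁ :- b₂ :* b₃)
    :z I O I = a :* (g₂ :* g₂ :- b₁ :* b₃)
    :z I I O = a :* (g₃ :* g₃ :- b₁ :* b₂)
    :z I I I = a :* (b₁ :* (g₁ :* g₁) :+ b₂ :* (g₂ :* g₂) :+ b₃ :* (g₃ :* g₃) :- b₁ :* b₂ :* b₃ :+ :2 :* g₁ :* g₂ :* g₃)

    :f₁ :f₂ :f₃ : Bool → Polynomial 7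
    :f₁ O = a :* g₁
    :f₁ I = a :* (g₂ :* g₃ :+ g₁ :* b₁)
    :f₂ O = a :* g₂
    :f₂ I = a :* (g₁ :* g₃ :+ g₂ :* b₂)
    :f₃ O = a :* g₃
    :f₃ I = a :* (g₁ :* g₂ :+ g₃ :* b₃)

    :σ : Sign → Polynomial 7
    :σ 1ₛ  = con (+ 1)
    :σ -1ₛ = con -[1+ 0 ]

    -- Twice the claimed value of K^C_v, with the other terms of K^C_v moved to this side.
    :corner : Bool → Bool → Bool → Polynomial 7
    :corner i j k = :2 :* (:σ (poleSign i j k) :* (:- :f₁ i :* (:- :f₂ j :* (:- :f₃ k :* con (+ 1))))
      :+ w I O O :* w O I O :* w O O I)
      where
      w : Bool → Bool → Bool → Polynomial 7
      w i′ j′ k′ = :z (i xor i′) (j xor j′) (k xor k′)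

    reflected : Bool → Bool → Bool → Polynomial 7
    reflected i j k = :numerator (λ i′ j′ k′ → :z (i xor i′) (j xor j′) (k xor k′))

    -- The parameters solve the hexahedron equations, so each of the eight claims becomes an
    -- unconditional polynomial identity in `a`, `b` and `g`.
    corner : ∀ i j k ρ → ⟦ reflected i j k ⟧ ρ ≈ ⟦ :corner i j k ⟧ ρ
    corner O O O = identity (reflected O O O) (:corner O O O) _
    corner O O I = identity (reflected O O I) (:corner O O I) _
    corner O I O = identity (reflected O I O) (:corner O I O) _
    corner O I I = identity (reflected O I I) (:corner O I I) _
    corner I O O = identity (reflected I O O) (:corner I O O) _
    corner I O I = identity (reflected I O I) (:corner I O I) _
    corner I I O = identity (reflected I I O) (:corner I I O) _
    corner I I I = identity (reflected I I I) (:corner I I I) _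

    module _ {z : Values} {f₁ f₁′ f₂ f₂′ f₃ f₃′ : Carrier} (z₀#0 : z O O O # 0#)
             (h : Hexahedron z f₁ f₁′ f₂ f₂′ f₃ f₃′) where
      open Hexahedron h

      private
        r = inverse z₀#0

        ρ : Vec Carrier 7
        ρ = z O O O ∷ z I O O * r ∷ z O I O * r ∷ z O O I * r ∷ f₁ * r ∷ f₂ * r ∷ f₃ * r ∷ []

        subtract : ∀ {x y s p q} → s ² ≈ x + y → s ≈ p → y ≈ q → x ≈ p * p - q
        subtract {x} {y} {s} {p} {q} s²≈x+y s≈p y≈q = begin
          x           ≈⟨ identity (var {2} 0F) (var 0F :+ var 1F :- var 1F) _ (x ∷ y ∷ []) ⟩
          x + y - y   ≈⟨ +-cong (trans (sym s²≈x+y) (*-cong s≈p s≈p)) (-‿cong y≈q) ⟩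
          p * p - q   ∎

      private
        scaled : ∀ x → x ≈ z O O O * (x * r)
        scaled x = sym (divide z₀#0 x)

        z₀₁₁≈ : z O I I ≈ ⟦ :z O I I ⟧ ρ
        z₀₁₁≈ = *-cancelˡ z₀#0 (trans
          (subtract square₁ (scaled f₁) (*-cong (scaled (z O I O)) (scaled (z O O I))))
          (identity (:f₁ O :* :f₁ O :- :z O I O :* :z O O I) (a :* :z O I I) _ ρ))

        z₁₀₁≈ : z I O I ≈ ⟦ :z I O I ⟧ ρ
        z₁₀₁≈ = *-cancelˡ z₀#0 (trans
          (subtract square₂ (scaled f₂) (*-cong (scaled (z I O O)) (scaled (z O O I))))
          (identity (:f₂ O :* :f₂ O :- :z I O O :* :z O O I) (a :* :z I O I) _ ρ))

        z₁₁₀≈ : z I I O ≈ ⟦ :z I I O ⟧ ρ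
        z₁₁₀≈ = *-cancelˡ z₀#0 (trans
          (subtract square₃ (scaled f₃) (*-cong (scaled (z I O O)) (scaled (z O I O))))
          (identity (:f₃ O :* :f₃ O :- :z I O O :* :z O I O) (a :* :z I I O) _ ρ))

        z₁₁₁≈ : z I I I ≈ ⟦ :z I I I ⟧ ρ
        z₁₁₁≈ = *-cancelˡ z₀#0 (*-cancelˡ z₀#0 (trans (trans eq₁₁₁ (+-cong
            (+-cong (*-cong (*-cong (*-congˡ (scaled (z I O O))) (scaled (z O I O))) (scaled (z O O I)))
              (*-congˡ (+-cong (+-cong (*-cong (scaled (z I O O)) z₀₁₁≈) (*-cong (scaled (z O I O)) z₁₀₁≈))
                (*-cong (scaled (z O O I)) z₁₁₀≈))))
            (*-cong (*-cong (*-congˡ (scaled f₁)) (scaled f₂)) (scaled f₃))))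
          (identity (:2 :* :z I O O :* :z O I O :* :z O O I
                :+ a :* (:z I O O :* :z O I I :+ :z O I O :* :z I O I :+ :z O O I :* :z I I O)
                :+ :2 :* :f₁ O :* :f₂ O :* :f₃ O)
            (a :* (a :* :z I I I)) _ ρ)))

      z≈ : ∀ i j k → z i j k ≈ ⟦ :z i j k ⟧ ρ
      z≈ O O O = refl
      z≈ I O O = scaled _
      z≈ O I O = scaled _
      z≈ O O I = scaled _
      z≈ O I I = z₀₁₁≈
      z≈ I O I = z₁₀₁≈
      z≈ I I O = z₁₁₀≈
      z≈ I I I = z₁₁₁≈

      pair : Carrier → Carrier → Bool → Carrier
      pair f f′ i = if i then f′ else f

      f₁≈ : ∀ i → pair f₁ f₁′ i ≈ ⟦ :f₁ i ⟧ ρ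
      f₁≈ O = scaled _
      f₁≈ I = *-cancelˡ z₀#0 (trans
        (trans eq₁ (+-cong (*-cong (scaled f₂) (scaled f₃)) (*-cong (scaled f₁) (scaled (z I O O)))))
        (identity (:f₂ O :* :f₃ O :+ :f₁ O :* :z I O O) (a :* :f₁ I) _ ρ))

      f₂≈ : ∀ i → pair f₂ f₂′ i ≈ ⟦ :f₂ i ⟧ ρ
      f₂≈ O = scaled _
      f₂≈ I = *-cancelˡ z₀#0 (trans
        (trans eq₂ (+-cong (*-cong (scaled f₁) (scaled f₃)) (*-cong (scaled f₂) (scaled (z O I O)))))
        (identity (:f₁ O :* :f₃ O :+ :f₂ O :* :z O I O) (a :* :f₂ I) _ ρ))

      f₃≈ : ∀ i → pair f₃ f₃′ i ≈ ⟦ :f₃ i ⟧ ρ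
      f₃≈ O = scaled _
      f₃≈ I = *-cancelˡ z₀#0 (trans
        (trans eq₃ (+-cong (*-cong (scaled f₁) (scaled f₂)) (*-cong (scaled f₃) (scaled (z O O I)))))
        (identity (:f₁ O :* :f₂ O :+ :f₃ O :* :z O O I) (a :* :f₃ I) _ ρ))

      -- In the parameters this is the Desnanot-Jacobi identity for the symmetric matrix with
      -- diagonal `b` and off-diagonal entries `- g`: two principal minors, one mixed minor, the
      -- determinant and the entry `b₁`. It shows that the forced value on an upper face is again a
      -- square root of the face quantity, as the next cubes need.
      square₁′ : f₁′ ² ≈ z I I I * z I O O + z I I O * z I O I
      square₁′ = begin
        f₁′ ²       ≈⟨ *-cong (f₁≈ I) (f₁≈ I) ⟩
        _           ≈⟨ identity (:f₁ I :* :f₁ I) (:z I I I :* :z I O O :+ :z I I O :* :z I O I) _ ρ ⟩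
        _           ≈⟨ +-cong (*-cong (z≈ I I I) (z≈ I O O)) (*-cong (z≈ I I O) (z≈ I O I)) ⟨
        _           ∎

      square₂′ : f₂′ ² ≈ z I I I * z O I O + z I I O * z O I I
      square₂′ = begin
        f₂′ ²       ≈⟨ *-cong (f₂≈ I) (f₂≈ I) ⟩
        _           ≈⟨ identity (:f₂ I :* :f₂ I) (:z I I I :* :z O I O :+ :z I I O :* :z O I I) _ ρ ⟩
        _           ≈⟨ +-cong (*-cong (z≈ I I I) (z≈ O I O)) (*-cong (z≈ I I O) (z≈ O I I)) ⟨
        _           ∎

      square₃′ : f₃′ ² ≈ z I I I * z O O I + z I O I * z O I I
      square₃′ = begin
        f₃′ ²       ≈⟨ *-cong (f₃≈ I) (f₃≈ I) ⟩
        _           ≈⟨ identity (:f₃ I :* :f₃ I) (:z I I I :* :z O O I :+ :z I O I :* :z O I I) _ ρ ⟩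
        _           ≈⟨ +-cong (*-cong (z≈ I I I) (z≈ O O I)) (*-cong (z≈ I O I) (z≈ O I I)) ⟨
        _           ∎

      kashaev₀₀₀≈ : ∀ i j k →
        kashaev₀₀₀ 𝔽 (λ i′ j′ k′ → z (i xor i′) (j xor j′) (k xor k′)) ≈
        σ (poleSign i j k) * (- pair f₁ f₁′ i * (- pair f₂ f₂′ j * (- pair f₃ f₃′ k * 1#)))
      kashaev₀₀₀≈ i j k = begin
        N * half - z₁ * z₂ * z₃
          ≈⟨ +-cong (*-congʳ N≈) (-‿cong (*-cong (*-cong (w≈ I O O) (w≈ O I O)) (w≈ O O I))) ⟩
        -- `half` is a variable for the solver, so `2# * half` has to be cancelled separately in
        -- each summand.
        2# * (Q + Z) * half - Z
          ≈⟨ identity (:2 :* (X :+ Y) :* H :- Y) (:2 :* (X :* H) :+ :2 :* (Y :* H) :- Y) _ (Q ∷ Z ∷ half ∷ []) ⟩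
        2# * (Q * half) + 2# * (Z * half) - Z  ≈⟨ +-congʳ (+-cong (divide 2#0 Q) (divide 2#0 Z)) ⟩
        Q + Z - Z                         ≈⟨ identity (X :+ Y :- Y) X _ (Q ∷ Z ∷ half ∷ []) ⟩
        Q
          ≈⟨ *-cong (σ≈ (poleSign i j k)) (*-cong (-‿cong (f₁≈ i)) (*-cong (-‿cong (f₂≈ j)) (*-congʳ (-‿cong (f₃≈ k))))) ⟨
        _                                 ∎
        where
        X = var {3} 0F
        Y = var {3} 1F
        H = var {3} 2F
        half = inverse 2#0

        :w : Bool → Bool → Bool → Polynomial 7
        :w i′ j′ k′ = :z (i xor i′) (j xor j′) (k xor k′)

        w : Values
        w i′ j′ k′ = z (i xor i′) (j xor j′) (k xor k′)

        w≈ : ∀ i′ j′ k′ → w i′ j′ k′ ≈ ⟦ :w i′ j′ k′ ⟧ ρ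
        w≈ i′ j′ k′ = z≈ (i xor i′) (j xor j′) (k xor k′)

        z₁ = w I O O
        z₂ = w O I O
        z₃ = w O O I
        N = numerator w
        Z = ⟦ :w I O O :* :w O I O :* :w O O I ⟧ ρ
        Q = ⟦ :σ (poleSign i j k) :* (:- :f₁ i :* (:- :f₂ j :* (:- :f₃ k :* con (+ 1)))) ⟧ ρ

        σ≈ : ∀ s → σ s ≈ ⟦ :σ s ⟧ ρ
        σ≈ 1ₛ  = refl
        σ≈ -1ₛ = refl

        N≈ : N ≈ 2# * (Q + Z)
        N≈ = trans
          (+-cong (*-cong (w≈ I I I) (*-cong (w≈ O O O) (w≈ O O O)))
            (-‿cong (*-cong (w≈ O O O) (+-cong (+-cong (*-cong (w≈ I O O) (w≈ O I I)) (*-cong (w≈ O I O) (w≈ I O I)))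
              (*-cong (w≈ O O I) (w≈ I I O))))))
          (corner i j k ρ)

  module _ {z : Values} {f₁ f₁′ f₂ f₂′ f₃ f₃′ : Carrier} (z₀#0 : z O O O # 0#)
           (h : Hexahedron z f₁ f₁′ f₂ f₂′ f₃ f₃′) (s t : Sign) {g₁ g₂ g₃ : Bool → Carrier}
           (g₁≈ : g₁ O ≈ σ s * σ t * f₁) (g₁′≈ : g₁ I ≈ σ s * σ t * f₁′)
           (g₂≈ : g₂ O ≈ σ s * f₂) (g₂′≈ : g₂ I ≈ σ s * f₂′)
           (g₃≈ : g₃ O ≈ σ t * f₃) (g₃′≈ : g₃ I ≈ σ t * f₃′) where
    open Hexahedron h

    private
      S  = var {8} 0F
      T  = var {8} 1F
      F₁ = var {8} 2F
      F₂ = var {8} 3F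
      F₃ = var {8} 4F
      Z  = var {8} 5F
      B  = var {8} 6F
      F′ = var {8} 7F

    -- The signs `s t`, `s`, `t` on the three directions have product 1, so the product of any two
    -- is the third: the two terms on the right of each face equation acquire the sign of its left
    -- side, and `f₁ f₂ f₃` is unchanged. Two signs are free and the third is forced, hence the
    -- parameters `s` and `t`.
    rescale : KHexahedronCube 𝔽 z z₀#0 g₁ g₂ g₃
    rescale = record
      { eq₁ = quotient z₀#0 (begin
          z O O O * g₁ I                                  ≈⟨ *-congˡ g₁′≈ ⟩
          z O O O * (σ s * σ t * f₁′)
            ≈⟨ identity (Z :* (S :* T :* F′)) (S :* T :* (Z :* F′)) _ (ρ (z I O O) f₁′) ⟩
          σ s * σ t * (z O O O * f₁′)                     ≈⟨ *-congˡ eq₁ ⟩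
          σ s * σ t * (f₂ * f₃ + f₁ * z I O O)
            ≈⟨ identity (S :* T :* (F₂ :* F₃ :+ F₁ :* B)) (S :* F₂ :* (T :* F₃) :+ S :* T :* F₁ :* B) _ (ρ (z I O O) f₁′) ⟩
          σ s * f₂ * (σ t * f₃) + σ s * σ t * f₁ * z I O O ≈⟨ +-cong (*-cong g₂≈ g₃≈) (*-congʳ g₁≈) ⟨
          g₂ O * g₃ O + g₁ O * z I O O                     ∎)
      ; eq₂ = quotient z₀#0 (begin
          z O O O * g₂ I                                  ≈⟨ *-congˡ g₂′≈ ⟩
          z O O O * (σ s * f₂′)
            ≈⟨ identity (Z :* (S :* F′)) (S :* (Z :* F′)) _ (ρ (z O I O) f₂′) ⟩
          σ s * (z O O O * f₂′)                           ≈⟨ *-congˡ eq₂ ⟩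
          σ s * (f₁ * f₃ + f₂ * z O I O)                  ≈⟨ *-congˡ (+-congʳ (σ-involutive t _)) ⟨
          σ s * (σ t * (σ t * (f₁ * f₃)) + f₂ * z O I O)
            ≈⟨ identity (S :* (T :* (T :* (F₁ :* F₃)) :+ F₂ :* B))
                 (S :* T :* F₁ :* (T :* F₃) :+ S :* F₂ :* B) _ (ρ (z O I O) f₂′) ⟩
          σ s * σ t * f₁ * (σ t * f₃) + σ s * f₂ * z O I O ≈⟨ +-cong (*-cong g₁≈ g₃≈) (*-congʳ g₂≈) ⟨
          g₁ O * g₃ O + g₂ O * z O I O                     ∎)
      ; eq₃ = quotient z₀#0 (begin
          z O O O * g₃ I                                  ≈⟨ *-congˡ g₃′≈ ⟩
          z O O O * (σ t * f₃′)
            ≈⟨ identity (Z :* (T :* F′)) (T :* (Z :* F′)) _ (ρ (z O O I) f₃′) ⟩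
          σ t * (z O O O * f₃′)                           ≈⟨ *-congˡ eq₃ ⟩
          σ t * (f₁ * f₂ + f₃ * z O O I)                  ≈⟨ *-congˡ (+-congʳ (σ-involutive s _)) ⟨
          σ t * (σ s * (σ s * (f₁ * f₂)) + f₃ * z O O I)
            ≈⟨ identity (T :* (S :* (S :* (F₁ :* F₂)) :+ F₃ :* B))
                 (S :* T :* F₁ :* (S :* F₂) :+ T :* F₃ :* B) _ (ρ (z O O I) f₃′) ⟩
          σ s * σ t * f₁ * (σ s * f₂) + σ t * f₃ * z O O I ≈⟨ +-cong (*-cong g₁≈ g₂≈) (*-congʳ g₃≈) ⟨
          g₁ O * g₂ O + g₃ O * z O O I                     ∎)
      ; eq₁₁₁ = quotient z₀#0 (quotient z₀#0 (trans eq₁₁₁ (+-congˡ (begin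
          2# * f₁ * f₂ * f₃                                      ≈⟨ σ-involutive s _ ⟨
          σ s * (σ s * (2# * f₁ * f₂ * f₃))                      ≈⟨ *-congˡ (*-congˡ (σ-involutive t _)) ⟨
          σ s * (σ s * (σ t * (σ t * (2# * f₁ * f₂ * f₃))))
            ≈⟨ identity (S :* (S :* (T :* (T :* (con (+ 2) :* F₁ :* F₂ :* F₃))))) (con (+ 2) :* (S :* T :* F₁) :* (S :* F₂) :* (T :* F₃)) _ (ρ (z O O I) f₃′) ⟩
          2# * (σ s * σ t * f₁) * (σ s * f₂) * (σ t * f₃)        ≈⟨ *-cong (*-cong (*-congˡ g₁≈) g₂≈) g₃≈ ⟨
          2# * g₁ O * g₂ O * g₃ O                                ∎))))
      }
      where
      ρ : Carrier → Carrier → Vec Carrier 8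
      ρ b f′ = σ s ∷ σ t ∷ f₁ ∷ f₂ ∷ f₃ ∷ z O O O ∷ b ∷ f′ ∷ []

  -- Every vertex of the cube lies on exactly one of the two faces of the first direction, so the
  -- sign placed on that pair enters each corner formula once and factors out.
  signed-kashaev₀₀₀≈ : ∀ {z f₁ f₁′ f₂ f₂′ f₃ f₃′} u → z O O O # 0# →
    Hexahedron z (σ u * f₁) (σ u * f₁′) f₂ f₂′ f₃ f₃′ → ∀ i j k →
    kashaev₀₀₀ 𝔽 (λ i′ j′ k′ → z (i xor i′) (j xor j′) (k xor k′)) ≈
    σ u * σ (poleSign i j k) * (- (if i then f₁′ else f₁) * (- (if j then f₂′ else f₂) * (- (if k then f₃′ else f₃) * 1#)))
  signed-kashaev₀₀₀≈ {f₁ = f₁} {f₁′} {f₂} {f₂′} {f₃} {f₃′} u z₀#0 h i j k =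
    trans (Parametrisation.kashaev₀₀₀≈ z₀#0 h i j k) (move i)
    where
    p = σ (poleSign i j k)
    R = - (if j then f₂′ else f₂) * (- (if k then f₃′ else f₃) * 1#)
    move : ∀ i → p * (- (if i then σ u * f₁′ else σ u * f₁) * R) ≈ σ u * p * (- (if i then f₁′ else f₁) * R)
    move O = identity (P :* (:- (U :* F) :* Q)) (U :* P :* (:- F :* Q)) _ (p ∷ σ u ∷ f₁ ∷ R ∷ [])
      where
      P = var {4} 0F
      U = var {4} 1F
      F = var {4} 2F
      Q = var {4} 3F
    move I = identity (P :* (:- (U :* F) :* Q)) (U :* P :* (:- F :* Q)) _ (p ∷ σ u ∷ f₁′ ∷ R ∷ [])
      where
      P = var {4} 0F
      U = var {4} 1F
      F = var {4} 2F
      Q = var {4} 3F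

-- Incidences in the complex of a pile.

module Combinatorics where
  open ≡ using (refl; sym; trans; cong; cong₂; subst)
  open import Data.Nat using (_+_)

  private
    variable
      n m : ℕ
      A B V W F : Set

  pattern at₀ = here refl
  pattern at₁ = there (here refl)
  pattern at₂ = there (there (here refl))
  pattern at₃ = there (there (there (here refl)))
  pattern at₄ = there (there (there (there (here refl))))
  pattern at₅ = there (there (there (there (there (here refl)))))
  pattern at₆ = there (there (there (there (there (there (here refl))))))
  pattern at₇ = there (there (there (there (there (there (there (here refl)))))))

  ≋-map : (g : V → W) {p q : Quad V} → p ≋ q → Vec.map g p ≋ Vec.map g q
  ≋-map g {q = _ ∷ _ ∷ _ ∷ _ ∷ []} = ∈-map⁺ (Vec.map g)

  ≋-sym : {p q : Quad V} → p ≋ q → q ≋ p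
  ≋-sym {q = _ ∷ _ ∷ _ ∷ _ ∷ []} at₀ = at₀
  ≋-sym {q = _ ∷ _ ∷ _ ∷ _ ∷ []} at₁ = at₃
  ≋-sym {q = _ ∷ _ ∷ _ ∷ _ ∷ []} at₂ = at₂
  ≋-sym {q = _ ∷ _ ∷ _ ∷ _ ∷ []} at₃ = at₁
  ≋-sym {q = _ ∷ _ ∷ _ ∷ _ ∷ []} at₄ = at₄
  ≋-sym {q = _ ∷ _ ∷ _ ∷ _ ∷ []} at₅ = at₅
  ≋-sym {q = _ ∷ _ ∷ _ ∷ _ ∷ []} at₆ = at₆
  ≋-sym {q = _ ∷ _ ∷ _ ∷ _ ∷ []} at₇ = at₇

  ∈-≋ : {p q : Quad V} → p ≋ q → ∀ {v} → v ∈ toList q → v ∈ toList p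
  ∈-≋ {V} {q = a ∷ b ∷ c ∷ d ∷ []} = cases
    where
    relabel : ∀ {ws} → a ∈ ws → b ∈ ws → c ∈ ws → d ∈ ws → ∀ {v : V} → v ∈ a ∷ b ∷ c ∷ d ∷ [] → v ∈ ws
    relabel a∈ b∈ c∈ d∈ at₀ = a∈
    relabel a∈ b∈ c∈ d∈ at₁ = b∈
    relabel a∈ b∈ c∈ d∈ at₂ = c∈
    relabel a∈ b∈ c∈ d∈ at₃ = d∈

    cases : {p : Quad V} → p ≋ (a ∷ b ∷ c ∷ d ∷ []) → ∀ {v} → v ∈ a ∷ b ∷ c ∷ d ∷ [] → v ∈ toList p
    cases at₀ = relabel at₀ at₁ at₂ at₃
    cases at₁ = relabel at₃ at₀ at₁ at₂
    cases at₂ = relabel at₂ at₃ at₀ at₁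
    cases at₃ = relabel at₁ at₂ at₃ at₀
    cases at₄ = relabel at₃ at₂ at₁ at₀
    cases at₅ = relabel at₂ at₁ at₀ at₃
    cases at₆ = relabel at₁ at₀ at₃ at₂
    cases at₇ = relabel at₀ at₃ at₂ at₁

  map-cong-∈ : {g h : V → W} (q : Quad V) → (∀ v → v ∈ toList q → g v ≡ h v) → Vec.map g q ≡ Vec.map h q
  map-cong-∈ (a ∷ b ∷ c ∷ d ∷ []) eq
    rewrite eq a at₀ | eq b at₁ | eq c at₂ | eq d at₃ = refl

  ∈-map-Quad : (g : V → W) (q : Quad V) {v : V} → v ∈ toList q → g v ∈ toList (Vec.map g q)
  ∈-map-Quad g (_ ∷ _ ∷ _ ∷ _ ∷ []) = ∈-map⁺ g

  -- The vertices are listed in the same order as in the fields oldᵢ and newᵢ of Flip.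
  module _ (C : Cube V F) where
    open Cube C

    quad₁ quad₂ quad₃ : Bool → Quad V
    quad₁ O = vertex O O O ∷ vertex O I O ∷ vertex O I I ∷ vertex O O I ∷ []
    quad₁ I = vertex I I I ∷ vertex I I O ∷ vertex I O O ∷ vertex I O I ∷ []
    quad₂ O = vertex O O O ∷ vertex I O O ∷ vertex I O I ∷ vertex O O I ∷ []
    quad₂ I = vertex I I I ∷ vertex I I O ∷ vertex O I O ∷ vertex O I I ∷ []
    quad₃ O = vertex O O O ∷ vertex I O O ∷ vertex I I O ∷ vertex O I O ∷ []
    quad₃ I = vertex I I I ∷ vertex I O I ∷ vertex O O I ∷ vertex O I I ∷ []

    ∈-quad₁ : ∀ i j k → vertex i j k ∈ toList (quad₁ i)
    ∈-quad₁ O O O = at₀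
    ∈-quad₁ O O I = at₃
    ∈-quad₁ O I O = at₁
    ∈-quad₁ O I I = at₂
    ∈-quad₁ I O O = at₂
    ∈-quad₁ I O I = at₃
    ∈-quad₁ I I O = at₁
    ∈-quad₁ I I I = at₀

    ∈-quad₂ : ∀ i j k → vertex i j k ∈ toList (quad₂ j)
    ∈-quad₂ O O O = at₀
    ∈-quad₂ O O I = at₃
    ∈-quad₂ O I O = at₂
    ∈-quad₂ O I I = at₃
    ∈-quad₂ I O O = at₁
    ∈-quad₂ I O I = at₂
    ∈-quad₂ I I O = at₁
    ∈-quad₂ I I I = at₀

    ∈-quad₃ : ∀ i j k → vertex i j k ∈ toList (quad₃ k)
    ∈-quad₃ O O O = at₀
    ∈-quad₃ O O I = at₂
    ∈-quad₃ O I O = at₃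
    ∈-quad₃ O I I = at₃
    ∈-quad₃ I O O = at₁
    ∈-quad₃ I O I = at₁
    ∈-quad₃ I I O = at₂
    ∈-quad₃ I I I = at₀

  -- The invariant carried up the pile. Its first three fields say that the current quadrangulation
  -- sits in the complex as its top; they are needed because a flip describes the hexagon by labels,
  -- whereas the incidences concern cells. Injectivity turns distinct labels into distinct vertices
  -- and faces of the new cube.
  record Consistent {R : Polygon n} (T : Quadrangulation R m) (𝐒 : Stage n m) : Set where
    open Stage 𝐒
    field
      vertexOf-injective : Injective _≡_ _≡_ vertexOf
      faceOf-injective   : Injective _≡_ _≡_ faceOf
      corners-faceOf     : ∀ f → corners (faceOf f) ≡ Vec.map vertexOf (Quadrangulation.corners T f)
      incident₁          : ∀ C i → corners (Cube.face₁ (cube C) i) ≋ quad₁ (cube C) i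
      incident₂          : ∀ C i → corners (Cube.face₂ (cube C) i) ≋ quad₂ (cube C) i
      incident₃          : ∀ C i → corners (Cube.face₃ (cube C) i) ≋ quad₃ (cube C) i
      faces-distinct     : ∀ c → Unique (cornerFaces c)

    cornerFaces⊆facesAt : ∀ c {S} → S ∈ cornerFaces c → cornerVertex c ∈ toList (corners S)
    cornerFaces⊆facesAt (C , i , j , k) at₀ = ∈-≋ (incident₁ C i) (∈-quad₁ (cube C) i j k)
    cornerFaces⊆facesAt (C , i , j , k) at₁ = ∈-≋ (incident₂ C j) (∈-quad₂ (cube C) i j k)
    cornerFaces⊆facesAt (C , i , j , k) at₂ = ∈-≋ (incident₃ C k) (∈-quad₃ (cube C) i j k)

  initial-consistent : {R : Polygon n} (T : Quadrangulation R m) → Consistent T (initial T)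
  initial-consistent T = record
    { vertexOf-injective = λ eq → eq
    ; faceOf-injective   = λ eq → eq
    ; corners-faceOf     = λ f → sym (Vec.map-id _)
    ; incident₁          = λ ()
    ; incident₂          = λ ()
    ; incident₃          = λ ()
    ; faces-distinct     = λ ()
    }

  module Attach {R : Polygon n} {T T′ : Quadrangulation R m} (𝐒 : Stage n m) (φ : Flip T T′) where
    open Stage 𝐒
    open Flip φ
    private
      module T  = Quadrangulation T
      module T′ = Quadrangulation T′
      module S′ = Stage (attach 𝐒 φ)

    vertexOf′-w : vertexOf′ 𝐒 φ w ≡ zero
    vertexOf′-w with w ≟ w
    ... | yes _  = refl
    ... | no w≢w = ⊥-elim (w≢w refl)

    vertexOf′-≢ : ∀ {a} → a ≢ w → vertexOf′ 𝐒 φ a ≡ suc (vertexOf a)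
    vertexOf′-≢ {a} a≢w with a ≟ w
    ... | yes a≡w = ⊥-elim (a≢w a≡w)
    ... | no _    = refl

    -- The index is the value of `faceOf′`, so matching on the view also resolves its nested
    -- conditionals.
    data FaceView (f : Fin m) : Fin (3 ℕ.+ #²) → Set where
      new₁-face : f ≡ t₁ → FaceView f 0F
      new₂-face : f ≡ t₂ → FaceView f 1F
      new₃-face : f ≡ t₃ → FaceView f 2F
      old-face  : f ∉ t₁ ∷ t₂ ∷ t₃ ∷ [] → FaceView f (3 ↑ʳ faceOf f)

    faceView : ∀ f → FaceView f (faceOf′ 𝐒 φ f)
    faceView f with f ≟ t₁ | f ≟ t₂ | f ≟ t₃
    ... | yes eq | _      | _      = new₁-face eq
    ... | no _   | yes eq | _      = new₂-face eq
    ... | no _   | no _   | yes eq = new₃-face eq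
    ... | no ≢₁  | no ≢₂  | no ≢₃  = old-face λ where
      (here eq)                 → ≢₁ eq
      (there (here eq))         → ≢₂ eq
      (there (there (here eq))) → ≢₃ eq

    -- Distinctness of the hexagon vertices separates the tiles: `e₂` lies on `t₁` but not on `t₂`,
    -- `e₂₃` on `t₁` but not on `t₃`, and `e₃` on `t₂` but not on `t₃`.
    tiles-distinct : Unique (t₁ ∷ t₂ ∷ t₃ ∷ [])
    tiles-distinct with vertices-distinct
    ... | (_ ∷ _ ∷ w≢e₂ ∷ w≢e₂₃ ∷ w≢e₃ ∷ _ ∷ []) ∷ (_ ∷ e₁≢e₂ ∷ e₁≢e₂₃ ∷ e₁≢e₃ ∷ _ ∷ [])
          ∷ (e₁₂≢e₂ ∷ e₁₂≢e₂₃ ∷ e₁₂≢e₃ ∷ _ ∷ []) ∷ (e₂≢e₂₃ ∷ e₂≢e₃ ∷ e₂≢e₁₃ ∷ [])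
          ∷ (e₂₃≢e₃ ∷ e₂₃≢e₁₃ ∷ []) ∷ (e₃≢e₁₃ ∷ []) ∷ [] ∷ []
        = ((λ eq → separate eq old₁ old₂ at₁ λ where
             at₀ → w≢e₂ refl
             at₁ → e₁≢e₂ refl
             at₂ → e₂≢e₁₃ refl
             at₃ → e₂≢e₃ refl)
          ∷ (λ eq → separate eq old₁ old₃ at₂ λ where
             at₀ → w≢e₂₃ refl
             at₁ → e₁≢e₂₃ refl
             at₂ → e₁₂≢e₂₃ refl
             at₃ → e₂≢e₂₃ refl)
          ∷ [])
          ∷ ((λ eq → separate eq old₂ old₃ at₃ λ where
             at₀ → w≢e₃ refl
             at₁ → e₁≢e₃ refl
             at₂ → e₁₂≢e₃ refl
             at₃ → e₂≢e₃ refl) ∷ [])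
          ∷ [] ∷ []
      where
      separate : ∀ {s t a p q} → s ≡ t → T.corners s ≋ p → T.corners t ≋ q → a ∈ toList p → ¬ (a ∉ toList q)
      separate refl s≋p t≋q a∈p a∉q = a∉q (∈-≋ (≋-sym t≋q) (∈-≋ s≋p a∈p))

    attach-consistent : Consistent T 𝐒 → Consistent T′ (attach 𝐒 φ)
    attach-consistent coh = record
      { vertexOf-injective = vertexOf′-injective
      ; faceOf-injective   = λ {f} {g} → faceOf′-injective (faceView f) (faceView g)
      ; corners-faceOf     = λ f → corners-faceOf′ (faceView f)
      ; incident₁          = λ where
          zero O    → old t₁ old₁
          zero I    → new e₁₂≢w e₁≢w e₁₃≢w new₁
          (suc C) O → ≋-map suc (incident₁ C O)
          (suc C) I → ≋-map suc (incident₁ C I)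
      ; incident₂          = λ where
          zero O    → old t₂ old₂
          zero I    → new e₁₂≢w e₂≢w e₂₃≢w new₂
          (suc C) O → ≋-map suc (incident₂ C O)
          (suc C) I → ≋-map suc (incident₂ C I)
      ; incident₃          = λ where
          zero O    → old t₃ old₃
          zero I    → new e₁₃≢w e₃≢w e₂₃≢w new₃
          (suc C) O → ≋-map suc (incident₃ C O)
          (suc C) I → ≋-map suc (incident₃ C I)
      ; faces-distinct     = λ where
          (zero , i , j , k)  → newFaces-distinct i j k
          (suc C , i , j , k) → Unique.map⁺ ↑-injective (faces-distinct (C , i , j , k))
      }
      where
      open Consistent coh

      ↑-injective : ∀ {k} {S S′ : Fin k} → 3 ↑ʳ S ≡ 3 ↑ʳ S′ → S ≡ S′
      ↑-injective refl = refl

      w≢ : ∀ {a} → a ∈ e₁ ∷ e₁₂ ∷ e₂ ∷ e₂₃ ∷ e₃ ∷ e₁₃ ∷ [] → a ≢ w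
      w≢ a∈ a≡w with vertices-distinct
      ... | w∉ ∷ _ = All.lookup w∉ a∈ (sym a≡w)

      e₁≢w  = w≢ at₀
      e₁₂≢w = w≢ at₁
      e₂≢w  = w≢ at₂
      e₂₃≢w = w≢ at₃
      e₃≢w  = w≢ at₄
      e₁₃≢w = w≢ at₅

      new : ∀ {t a b c} → a ≢ w → b ≢ w → c ≢ w → T′.corners t ≋ (w ∷ a ∷ b ∷ c ∷ []) →
            Vec.map (vertexOf′ 𝐒 φ) (T′.corners t) ≋ (zero ∷ Vec.map (suc ∘ vertexOf) (a ∷ b ∷ c ∷ []))
      new {t} {a} {b} {c} a≢w b≢w c≢w t≋ =
        subst (Vec.map (vertexOf′ 𝐒 φ) (T′.corners t) ≋_) labels (≋-map (vertexOf′ 𝐒 φ) t≋)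
        where
        labels : Vec.map (vertexOf′ 𝐒 φ) (w ∷ a ∷ b ∷ c ∷ []) ≡ zero ∷ Vec.map (suc ∘ vertexOf) (a ∷ b ∷ c ∷ [])
        labels rewrite vertexOf′-w | vertexOf′-≢ a≢w | vertexOf′-≢ b≢w | vertexOf′-≢ c≢w = refl

      old : ∀ t {a b c d} → T.corners t ≋ (a ∷ b ∷ c ∷ d ∷ []) →
            Vec.map suc (corners (faceOf t)) ≋ Vec.map (λ a → suc (vertexOf a)) (a ∷ b ∷ c ∷ d ∷ [])
      old t t≋ rewrite corners-faceOf t = ≋-map suc (≋-map vertexOf t≋)

      vertexOf′-injective : Injective _≡_ _≡_ (vertexOf′ 𝐒 φ)
      vertexOf′-injective {a} {b} eq with a ≟ w | b ≟ w
      ... | yes a≡w | yes b≡w = trans a≡w (sym b≡w)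
      ... | no _    | no _    = vertexOf-injective (suc-injective eq)
      vertexOf′-injective () | yes _ | no _
      vertexOf′-injective () | no _ | yes _

      faceOf′-injective : ∀ {f g S S′} → FaceView f S → FaceView g S′ → S ≡ S′ → f ≡ g
      faceOf′-injective (new₁-face f≡) (new₁-face g≡) _ = trans f≡ (sym g≡)
      faceOf′-injective (new₂-face f≡) (new₂-face g≡) _ = trans f≡ (sym g≡)
      faceOf′-injective (new₃-face f≡) (new₃-face g≡) _ = trans f≡ (sym g≡)
      faceOf′-injective (old-face _)   (old-face _)   eq = faceOf-injective (↑-injective eq)
      faceOf′-injective (new₁-face _) (new₂-face _) ()
      faceOf′-injective (new₁-face _) (new₃-face _) ()
      faceOf′-injective (new₁-face _) (old-face _)  ()
      faceOf′-injective (new₂-face _) (new₁-face _) ()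
      faceOf′-injective (new₂-face _) (new₃-face _) ()
      faceOf′-injective (new₂-face _) (old-face _)  ()
      faceOf′-injective (new₃-face _) (new₁-face _) ()
      faceOf′-injective (new₃-face _) (new₂-face _) ()
      faceOf′-injective (new₃-face _) (old-face _)  ()
      faceOf′-injective (old-face _)  (new₁-face _) ()
      faceOf′-injective (old-face _)  (new₂-face _) ()
      faceOf′-injective (old-face _)  (new₃-face _) ()

      corners-faceOf′ : ∀ {f S} → FaceView f S → S′.corners S ≡ Vec.map (vertexOf′ 𝐒 φ) (T′.corners f)
      corners-faceOf′ (new₁-face refl) = refl
      corners-faceOf′ (new₂-face refl) = refl
      corners-faceOf′ (new₃-face refl) = refl
      corners-faceOf′ {f} (old-face f∉) = begin
        Vec.map suc (corners (faceOf f))               ≡⟨ cong (Vec.map suc) (corners-faceOf f) ⟩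
        Vec.map suc (Vec.map vertexOf (T.corners f))   ≡⟨ Vec.map-∘ suc vertexOf (T.corners f) ⟨
        Vec.map (suc ∘ vertexOf) (T.corners f)
          -- `vertexOf′` and `suc ∘ vertexOf` differ only at `w`, and by `degree-3` a tile
          -- containing `w` is one of the three flipped ones.
          ≡⟨ map-cong-∈ (T.corners f) (λ a a∈f → sym (vertexOf′-≢ λ a≡w → f∉ (degree-3 f (subst (_∈ _) a≡w a∈f)))) ⟩
        Vec.map (vertexOf′ 𝐒 φ) (T.corners f)          ≡⟨ cong (Vec.map (vertexOf′ 𝐒 φ)) (unchanged f f∉) ⟨
        Vec.map (vertexOf′ 𝐒 φ) (T′.corners f)         ∎
        where open ≡-Reasoning

      newFaces-distinct : ∀ i j k → Unique (S′.cornerFaces (zero , i , j , k))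
      newFaces-distinct i j k with tiles-distinct
      ... | (t₁≢t₂ ∷ t₁≢t₃ ∷ []) ∷ (t₂≢t₃ ∷ []) ∷ [] ∷ [] =
        (new₁₂ i j ∷ new₁₃ i k ∷ []) ∷ (new₂₃ j k ∷ []) ∷ [] ∷ []
        where
        open Cube (newCube 𝐒 φ)
        old≢ : ∀ {s t} → s ≢ t → 3 ↑ʳ faceOf s ≢ 3 ↑ʳ faceOf t
        old≢ s≢t eq = s≢t (faceOf-injective (↑-injective eq))
        new₁₂ : ∀ i j → face₁ i ≢ face₂ j
        new₁₂ O O = old≢ t₁≢t₂
        new₁₂ O I ()
        new₁₂ I O ()
        new₁₂ I I ()
        new₁₃ : ∀ i j → face₁ i ≢ face₃ j
        new₁₃ O O = old≢ t₁≢t₃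
        new₁₃ O I ()
        new₁₃ I O ()
        new₁₃ I I ()
        new₂₃ : ∀ i j → face₂ i ≢ face₃ j
        new₂₃ O O = old≢ t₂≢t₃
        new₂₃ O I ()
        new₂₃ I O ()
        new₂₃ I I ()

  stage-consistent : {R : Polygon n} {T : Quadrangulation R m} (𝐓 : Pile T) → Consistent T (stage 𝐓)
  stage-consistent ⟨ T ⟩   = initial-consistent T
  stage-consistent (𝐓 ▷ φ) = Attach.attach-consistent (stage 𝐓) φ (stage-consistent 𝐓)

  -- Cubes around a vertex: incidence counts and pole signs.

  filter-map : {P : Pred A 0ℓ} {Q : Pred B 0ℓ} (P? : Decidable P) (Q? : Decidable Q) (g : A → B) →
               (∀ x → does (Q? (g x)) ≡ does (P? x)) → ∀ xs → filter Q? (map g xs) ≡ map g (filter P? xs)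
  filter-map P? Q? g eq []       = refl
  filter-map P? Q? g eq (x ∷ xs) rewrite eq x with does (P? x)
  ... | true  = cong (g x ∷_) (filter-map P? Q? g eq xs)
  ... | false = filter-map P? Q? g eq xs

  length-filter-≟ : (h : A → Fin n) (v : Fin n) (xs : List A) → Unique (map h xs) →
                    length (filter (λ x → h x ≟ v) xs) ≤ 1
  length-filter-≟ h v []       _ = z≤n
  length-filter-≟ h v (x ∷ xs) (x∉ ∷ unique) with h x ≟ v
  ... | no _     = length-filter-≟ h v xs unique
  ... | yes refl = ℕ.≤-reflexive (cong (ℕ.suc ∘ length) (List.filter-none (λ y → h y ≟ h x) (none x∉)))
    where
    none : ∀ {ys} → All (h x ≢_) (map h ys) → All (λ y → h y ≢ h x) ys
    none {[]}     []       = []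
    none {_ ∷ _} (p ∷ ps) = (λ eq → p (sym eq)) ∷ none ps

  ∏ₛ : List A → (A → Sign) → Sign
  ∏ₛ xs s = foldr _*ₛ_ 1ₛ (map s xs)

  ∏ₛ-++ : ∀ (xs ys : List A) s → ∏ₛ (xs ++ ys) s ≡ ∏ₛ xs s *ₛ ∏ₛ ys s
  ∏ₛ-++ []       ys s = refl
  ∏ₛ-++ (x ∷ xs) ys s = trans (cong (s x *ₛ_) (∏ₛ-++ xs ys s)) (sym (Sign.*-assoc (s x) _ _))

  ∏ₛ-filter : {P : Pred A 0ℓ} (P? : Decidable P) (s : A → Sign) (xs : List A) →
              ∏ₛ (filter P? xs) s ≡ ∏ₛ xs (λ x → if does (P? x) then s x else 1ₛ)
  ∏ₛ-filter P? s []       = refl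
  ∏ₛ-filter P? s (x ∷ xs) with does (P? x)
  ... | true  = cong (s x *ₛ_) (∏ₛ-filter P? s xs)
  ... | false = ∏ₛ-filter P? s xs

  private
    binary : List (Bool × Bool × Bool)
    binary = cartesianProduct (O ∷ I ∷ []) (cartesianProduct (O ∷ I ∷ []) (O ∷ I ∷ []))

  module _ (K : Complex) where
    open Complex K

    -- This is the length that `Interior.two-cubes` requires to be 2.
    count : Fin #⁰ → Fin #² → ℕ
    count v S = length (filter (λ c → S ∈? cornerFaces c) (cornersAt v))

    ∈-cornersAt⁻ : ∀ {v c} → c ∈ cornersAt v → cornerVertex c ≡ v
    ∈-cornersAt⁻ {v} = proj₂ ∘ ∈-filter⁻ (λ c → cornerVertex c ≟ v) {xs = cartesianProduct (allFin #³) binary}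

    poleSignAt : Corner → Sign
    poleSignAt (_ , i , j , k) = poleSign i j k

  private
    shift : ∀ {k} → Fin k × A → Fin (ℕ.suc k) × A
    shift (C , r) = suc C , r

    -- `allFin (suc k)` unfolds to `zero ∷ tabulate suc`; this treats the tail, and so separates the
    -- corners of the new cube from the shifted older ones.
    cartesianProduct-tabulate : ∀ k (ys : List A) →
      cartesianProduct (tabulate {n = k} suc) ys ≡ map shift (cartesianProduct (allFin k) ys)
    cartesianProduct-tabulate k ys = trans (cong (λ xs → cartesianProduct xs ys) (sym (List.map-tabulate id suc))) (mapped (allFin k))
      where
      mapped : ∀ xs → cartesianProduct (map suc xs) ys ≡ map shift (cartesianProduct xs ys)
      mapped []       = refl
      mapped (x ∷ xs) = begin
        map (suc x ,_) ys ++ cartesianProduct (map suc xs) ys            ≡⟨ cong₂ _++_ (List.map-∘ ys) (mapped xs) ⟩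
        map shift (map (x ,_) ys) ++ map shift (cartesianProduct xs ys)  ≡⟨ List.map-++ shift (map (x ,_) ys) _ ⟨
        map shift (map (x ,_) ys ++ cartesianProduct xs ys)              ∎
        where open ≡-Reasoning

  module AttachCount {R : Polygon n} {T T′ : Quadrangulation R m} (𝐒 : Stage n m) (φ : Flip T T′) (coh : Consistent T 𝐒) where
    open Stage 𝐒
    open Flip φ
    open Consistent coh
    private
      module S′ = Stage (attach 𝐒 φ)
      K′ = S′.complex

    fresh : Bool × Bool × Bool → S′.Corner
    fresh r = zero , r

    private
      atNew? : ∀ v (r : Bool × Bool × Bool) → Dec (S′.cornerVertex (fresh r) ≡ v)
      atNew? v r = S′.cornerVertex (fresh r) ≟ v

      at? : ∀ v (c : Corner) → Dec (cornerVertex c ≡ v)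
      at? v c = cornerVertex c ≟ v

      at′? : ∀ v (c : S′.Corner) → Dec (S′.cornerVertex c ≡ v)
      at′? v c = S′.cornerVertex c ≟ v

      on? : ∀ S (c : Corner) → Dec (S ∈ cornerFaces c)
      on? S c = S ∈? cornerFaces c

      on′? : ∀ S (c : S′.Corner) → Dec (S ∈ S′.cornerFaces c)
      on′? S c = S ∈? S′.cornerFaces c

      onNew? : ∀ S (r : Bool × Bool × Bool) → Dec (S ∈ S′.cornerFaces (fresh r))
      onNew? S r = S ∈? S′.cornerFaces (fresh r)

      oldCorners : List Corner
      oldCorners = cartesianProduct (allFin #³) binary

    newCornersAt : Fin #⁰ → List (Bool × Bool × Bool)
    newCornersAt v = filter (atNew? (suc v)) binary

    cornersAt-suc : ∀ v → S′.cornersAt (suc v) ≡ map fresh (newCornersAt v) ++ map shift (cornersAt v)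
    cornersAt-suc v = begin
      S′.cornersAt (suc v)
        ≡⟨ List.filter-++ (at′? (suc v)) (map fresh binary) (cartesianProduct (tabulate suc) binary) ⟩
      filter (at′? (suc v)) (map fresh binary) ++ filter (at′? (suc v)) (cartesianProduct (tabulate suc) binary)
        ≡⟨ cong₂ _++_ (filter-map (atNew? (suc v)) (at′? (suc v)) fresh (λ _ → refl) binary)
             (trans (cong (filter (at′? (suc v))) (cartesianProduct-tabulate #³ binary))
               (filter-map (at? v) (at′? (suc v)) shift (λ _ → refl) oldCorners)) ⟩
      map fresh (newCornersAt v) ++ map shift (cornersAt v)
        ∎
      where open ≡-Reasoning

    cornersAt-zero : S′.cornersAt zero ≡ (zero , I , I , I) ∷ []
    cornersAt-zero = cong ((zero , I , I , I) ∷_)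
      (trans (cong (filter (at′? zero)) (cartesianProduct-tabulate #³ binary)) (List.filter-none (at′? zero) (none oldCorners)))
      where
      none : ∀ cs → All (λ c → S′.cornerVertex c ≢ zero) (map shift cs)
      none []       = []
      none (_ ∷ cs) = (λ ()) ∷ none cs

    newCount : Fin #⁰ → Fin S′.#² → ℕ
    newCount v S = length (filter (onNew? S) (newCornersAt v))

    newVertices-distinct : ∀ v → length (newCornersAt v) ≤ 1
    newVertices-distinct v = length-filter-≟ (λ (i , j , k) → newVertex 𝐒 φ i j k) (suc v) binary distinct
      where
      distinct : Unique (map (λ (i , j , k) → newVertex 𝐒 φ i j k) binary)
      distinct with vertices-distinct
      ... | (w≢e₁ ∷ w≢e₁₂ ∷ w≢e₂ ∷ w≢e₂₃ ∷ w≢e₃ ∷ w≢e₁₃ ∷ []) ∷ (e₁≢e₁₂ ∷ e₁≢e₂ ∷ e₁≢e₂₃ ∷ e₁≢e₃ ∷ e₁≢e₁₃ ∷ [])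
            ∷ (e₁₂≢e₂ ∷ e₁₂≢e₂₃ ∷ e₁₂≢e₃ ∷ e₁₂≢e₁₃ ∷ []) ∷ (e₂≢e₂₃ ∷ e₂≢e₃ ∷ e₂≢e₁₃ ∷ [])
            ∷ (e₂₃≢e₃ ∷ e₂₃≢e₁₃ ∷ []) ∷ (e₃≢e₁₃ ∷ []) ∷ [] ∷ [] =
          (apart w≢e₃ ∷ apart w≢e₂ ∷ apart w≢e₂₃ ∷ apart w≢e₁ ∷ apart w≢e₁₃ ∷ apart w≢e₁₂ ∷ (λ ()) ∷ [])
        ∷ (apart′ e₂≢e₃ ∷ apart′ e₂₃≢e₃ ∷ apart′ e₁≢e₃ ∷ apart e₃≢e₁₃ ∷ apart′ e₁₂≢e₃ ∷ (λ ()) ∷ [])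
        ∷ (apart e₂≢e₂₃ ∷ apart′ e₁≢e₂ ∷ apart e₂≢e₁₃ ∷ apart′ e₁₂≢e₂ ∷ (λ ()) ∷ [])
        ∷ (apart′ e₁≢e₂₃ ∷ apart e₂₃≢e₁₃ ∷ apart′ e₁₂≢e₂₃ ∷ (λ ()) ∷ [])
        ∷ (apart e₁≢e₁₃ ∷ apart e₁≢e₁₂ ∷ (λ ()) ∷ [])
        ∷ (apart′ e₁₂≢e₁₃ ∷ (λ ()) ∷ [])
        ∷ ((λ ()) ∷ [])
        ∷ []
        ∷ []
        where
        apart : ∀ {a b} → a ≢ b → suc (vertexOf a) ≢ suc (vertexOf b)
        apart a≢b eq = a≢b (vertexOf-injective (suc-injective eq))
        apart′ : ∀ {a b} → a ≢ b → suc (vertexOf b) ≢ suc (vertexOf a)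
        apart′ a≢b eq = apart a≢b (sym eq)

    newCount≤1 : ∀ v S → newCount v S ≤ 1
    newCount≤1 v S = ℕ.≤-trans (List.length-filter (onNew? S) (newCornersAt v)) (newVertices-distinct v)

    count-suc : ∀ v S → count K′ (suc v) S ≡ newCount v S + length (filter (on′? S) (map shift (cornersAt v)))
    count-suc v S = begin
      count K′ (suc v) S
        ≡⟨ cong (length ∘ filter (on′? S)) (cornersAt-suc v) ⟩
      length (filter (on′? S) (map fresh new ++ map shift (cornersAt v)))
        ≡⟨ cong length (List.filter-++ (on′? S) (map fresh new) (map shift (cornersAt v))) ⟩
      length (filter (on′? S) (map fresh new) ++ filter (on′? S) (map shift (cornersAt v)))
        ≡⟨ List.length-++ (filter (on′? S) (map fresh new)) ⟩
      length (filter (on′? S) (map fresh new)) + length (filter (on′? S) (map shift (cornersAt v)))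
        ≡⟨ cong (_+ length (filter (on′? S) (map shift (cornersAt v))))
             (trans (cong length (filter-map (onNew? S) (on′? S) fresh (λ _ → refl) new))
               (List.length-map fresh (filter (onNew? S) new))) ⟩
      newCount v S + length (filter (on′? S) (map shift (cornersAt v)))
        ∎
      where
      open ≡-Reasoning
      new = newCornersAt v

    count-suc-old : ∀ v S → count K′ (suc v) (3 ↑ʳ S) ≡ newCount v (3 ↑ʳ S) + count complex v S
    count-suc-old v S = trans (count-suc v (3 ↑ʳ S)) (cong (λ k → newCount v (3 ↑ʳ S) + k)
      (trans (cong length (filter-map (on? S) (on′? (3 ↑ʳ S)) shift (λ _ → refl) (cornersAt v)))
        (List.length-map shift (filter (on? S) (cornersAt v)))))

    -- No older cube contains a new face, and an old vertex occurs at most once in the new cube.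
    count-suc-new : ∀ v S → (∀ S₀ → S ≢ 3 ↑ʳ S₀) → count K′ (suc v) S ≤ 1
    count-suc-new v S new = ℕ.≤-trans (ℕ.≤-reflexive (trans (count-suc v S)
        (trans (cong (λ cs → newCount v S + length cs) (List.filter-none (on′? S) (none (cornersAt v)))) (ℕ.+-identityʳ _))))
      (newCount≤1 v S)
      where
      none : ∀ cs → All (λ c → S ∉ S′.cornerFaces c) (map shift cs)
      none []       = []
      none (_ ∷ cs) = (λ where
        (here eq)                 → new _ eq
        (there (here eq))         → new _ eq
        (there (there (here eq))) → new _ eq) ∷ none cs

    count-zero≤1 : ∀ S → count K′ zero S ≤ 1
    count-zero≤1 S = ℕ.≤-trans (List.length-filter (on′? S) (S′.cornersAt zero)) (ℕ.≤-reflexive (cong length cornersAt-zero))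

    count-zero-old : ∀ S → count K′ zero (3 ↑ʳ S) ≡ 0
    count-zero-old S = cong (length ∘ filter (on′? (3 ↑ʳ S))) cornersAt-zero

    newCount-old : ∀ v S → (∀ {t} → t ∈ t₁ ∷ t₂ ∷ t₃ ∷ [] → S ≢ faceOf t) → newCount v (3 ↑ʳ S) ≡ 0
    newCount-old v S S≢ = cong length (List.filter-none (onNew? (3 ↑ʳ S)) (All.universal outside (newCornersAt v)))
      where
      outside : ∀ r → 3 ↑ʳ S ∉ S′.cornerFaces (zero , r)
      outside (O , _ , _) at₀ = S≢ at₀ refl
      outside (_ , O , _) at₁ = S≢ at₁ refl
      outside (_ , _ , O) at₂ = S≢ at₂ refl

    poleSign-zero : ∏ₛ (S′.cornersAt zero) (poleSignAt K′) ≡ -1ₛ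
    poleSign-zero = cong (λ cs → ∏ₛ cs (poleSignAt K′)) cornersAt-zero

    -- The top of the new cube is the new vertex, so among the old vertices only its bottom acquires
    -- a sign.
    poleSign-suc : ∀ v → ∏ₛ (S′.cornersAt (suc v)) (poleSignAt K′) ≡
      (if does (vertexOf w ≟ v) then -1ₛ else 1ₛ) *ₛ ∏ₛ (cornersAt v) (poleSignAt complex)
    poleSign-suc v = begin
      ∏ₛ (S′.cornersAt (suc v)) (poleSignAt K′)
        ≡⟨ cong (λ cs → ∏ₛ cs (poleSignAt K′)) (cornersAt-suc v) ⟩
      ∏ₛ (map fresh (newCornersAt v) ++ map shift (cornersAt v)) (poleSignAt K′)
        ≡⟨ ∏ₛ-++ (map fresh (newCornersAt v)) (map shift (cornersAt v)) (poleSignAt K′) ⟩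
      ∏ₛ (map fresh (newCornersAt v)) (poleSignAt K′) *ₛ ∏ₛ (map shift (cornersAt v)) (poleSignAt K′)
        ≡⟨ cong₂ _*ₛ_ (cong (foldr _*ₛ_ 1ₛ) (sym (List.map-∘ (newCornersAt v))))
           (cong (foldr _*ₛ_ 1ₛ) (sym (List.map-∘ (cornersAt v)))) ⟩
      ∏ₛ (newCornersAt v) (λ (i , j , k) → poleSign i j k) *ₛ ∏ₛ (cornersAt v) (poleSignAt complex)
        ≡⟨ cong (_*ₛ _) (trans (∏ₛ-filter (atNew? (suc v)) (λ (i , j , k) → poleSign i j k) binary) new) ⟩
      (if does (vertexOf w ≟ v) then -1ₛ else 1ₛ) *ₛ ∏ₛ (cornersAt v) (poleSignAt complex)
        ∎
      where
      open ≡-Reasoning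
      trivial : ∀ b → (if b then 1ₛ else 1ₛ) ≡ 1ₛ
      trivial true  = refl
      trivial false = refl
      new : ∏ₛ binary (λ (i , j , k) → if does (newVertex 𝐒 φ i j k ≟ suc v) then poleSign i j k else 1ₛ) ≡
            (if does (vertexOf w ≟ v) then -1ₛ else 1ₛ)
      -- At the six hexagon vertices `poleSign` is `1ₛ`, so both branches of the conditional agree;
      -- the top is `zero`, which is never `suc v`.
      new rewrite trivial (does (vertexOf e₁ ≟ v)) | trivial (does (vertexOf e₂ ≟ v)) | trivial (does (vertexOf e₃ ≟ v))
                | trivial (does (vertexOf e₁₂ ≟ v)) | trivial (does (vertexOf e₁₃ ≟ v)) | trivial (does (vertexOf e₂₃ ≟ v))
                = Sign.*-identityʳ _

  -- A face on the current top has no cube above it yet, so only the cube that created it can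
  -- contain it. In the induction, a face created last lies in the last cube alone, and a face kept
  -- by the flip does not lie in the last cube.
  count-faceOf : {R : Polygon n} {T : Quadrangulation R m} (𝐓 : Pile T) → let open Stage (stage 𝐓) in
                 ∀ f v → count complex v (faceOf f) ≤ 1
  count-faceOf ⟨ T ⟩   f v = z≤n
  count-faceOf (𝐓 ▷ φ) f v = step (faceView f) v
    where
    open Stage (stage 𝐓)
    open Consistent (stage-consistent 𝐓)
    open Attach (stage 𝐓) φ
    open AttachCount (stage 𝐓) φ (stage-consistent 𝐓)

    step : ∀ {S} → FaceView f S → ∀ v → count (ϰ (𝐓 ▷ φ)) v S ≤ 1
    step {S} _         zero    = count-zero≤1 S
    step (new₁-face _) (suc v) = count-suc-new v 0F λ _ ()
    step (new₂-face _) (suc v) = count-suc-new v 1F λ _ ()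
    step (new₃-face _) (suc v) = count-suc-new v 2F λ _ ()
    step (old-face f∉) (suc v) = ℕ.≤-trans
      (ℕ.≤-reflexive (trans (count-suc-old v (faceOf f)) (cong (_+ _) (newCount-old v (faceOf f)
        λ t∈ eq → f∉ (subst (_∈ _) (sym (faceOf-injective eq)) t∈)))))
      (count-faceOf 𝐓 f v)

  InitialFace : {R : Polygon n} {T : Quadrangulation R m} (𝐓 : Pile T) → Fin (Complex.#² (ϰ 𝐓)) → Set
  InitialFace ⟨ T ⟩   S                   = ⊤
  InitialFace (𝐓 ▷ φ) 0F                  = ⊥
  InitialFace (𝐓 ▷ φ) 1F                  = ⊥
  InitialFace (𝐓 ▷ φ) 2F                  = ⊥
  InitialFace (𝐓 ▷ φ) (suc (suc (suc S))) = InitialFace 𝐓 S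

  -- An initial face is not created by any cube, so while it is still on top no cube contains it.
  -- This sharpening of `count-faceOf` is what `count-initial` needs at the flip that buries the
  -- face.
  count-initial-faceOf : {R : Polygon n} {T : Quadrangulation R m} (𝐓 : Pile T) → let open Stage (stage 𝐓) in
                         ∀ f v → InitialFace 𝐓 (faceOf f) → count complex v (faceOf f) ≡ 0
  count-initial-faceOf ⟨ T ⟩   f v _ = refl
  count-initial-faceOf (𝐓 ▷ φ) f v   = step (faceView f) v
    where
    open Stage (stage 𝐓)
    open Consistent (stage-consistent 𝐓)
    open Attach (stage 𝐓) φ
    open AttachCount (stage 𝐓) φ (stage-consistent 𝐓)

    step : ∀ {S} → FaceView f S → ∀ v → InitialFace (𝐓 ▷ φ) S → count (ϰ (𝐓 ▷ φ)) v S ≡ 0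
    step (old-face _)  zero    _    = count-zero-old (faceOf f)
    step (old-face f∉) (suc v) init = trans (count-suc-old v (faceOf f)) (cong₂ _+_
      (newCount-old v (faceOf f) λ t∈ eq → f∉ (subst (_∈ _) (sym (faceOf-injective eq)) t∈))
      (count-initial-faceOf 𝐓 f v init))

  -- If the face was on top before the last flip, the older cubes contribute 0 and the new one at
  -- most 1. Otherwise it was buried earlier, the new cube misses it, and the induction hypothesis
  -- applies.
  count-initial : {R : Polygon n} {T : Quadrangulation R m} (𝐓 : Pile T) →
                  ∀ S v → InitialFace 𝐓 S → count (ϰ 𝐓) v S ≤ 1
  count-initial ⟨ T ⟩   S                   v       _    = z≤n
  count-initial (𝐓 ▷ φ) (suc (suc (suc S))) zero    _    = AttachCount.count-zero≤1 (stage 𝐓) φ (stage-consistent 𝐓) (3 ↑ʳ S)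
  count-initial (𝐓 ▷ φ) (suc (suc (suc S))) (suc v) init with any? (λ f → S ≟ Stage.faceOf (stage 𝐓) f)
  ... | yes (f , refl) = ℕ.≤-trans
      (ℕ.≤-reflexive (trans (count-suc-old v S) (trans
        (cong (λ k → newCount v (3 ↑ʳ S) + k) (count-initial-faceOf 𝐓 f v init)) (ℕ.+-identityʳ _))))
      (newCount≤1 v (3 ↑ʳ S))
    where open AttachCount (stage 𝐓) φ (stage-consistent 𝐓)
  ... | no  S≢ = ℕ.≤-trans
      (ℕ.≤-reflexive (trans (count-suc-old v S) (cong (_+ _) (newCount-old v S λ {t} _ eq → S≢ (t , eq)))))
      (count-initial 𝐓 S v init)
    where open AttachCount (stage 𝐓) φ (stage-consistent 𝐓)

  initialSign : {R : Polygon n} {T : Quadrangulation R m} (𝐓 : Pile T) → Fin (Complex.#⁰ (ϰ 𝐓)) → Sign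
  initialSign ⟨ T ⟩   v       = -1ₛ
  initialSign (𝐓 ▷ φ) zero    = 1ₛ
  initialSign (𝐓 ▷ φ) (suc v) = initialSign 𝐓 v

  initialSign-face : {R : Polygon n} {T : Quadrangulation R m} (𝐓 : Pile T) → let open Complex (ϰ 𝐓) in
                     ∀ v → initialSign 𝐓 v ≡ -1ₛ → ∃[ S ] (v ∈ toList (corners S) × InitialFace 𝐓 S)
  initialSign-face ⟨ T ⟩   v       _  = let f , v∈f = Quadrangulation.vertices-covered T v in f , v∈f , tt
  initialSign-face (𝐓 ▷ φ) (suc v) eq =
    let S , v∈S , init = initialSign-face 𝐓 v eq in 3 ↑ʳ S , ∈-map-Quad suc (Complex.corners (ϰ 𝐓) S) v∈S , init

  finalSign : (𝐒 : Stage n m) → Fin (Stage.#⁰ 𝐒) → Sign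
  finalSign 𝐒 v = if does (any? (λ a → Stage.vertexOf 𝐒 a ≟ v)) then -1ₛ else 1ₛ

  -- A vertex is the top of one cube unless it is initial, and the bottom of one cube unless it is final.
  ∏-poleSign : {R : Polygon n} {T : Quadrangulation R m} (𝐓 : Pile T) → let open Complex (ϰ 𝐓) in
    ∀ v → ∏ₛ (cornersAt v) (poleSignAt (ϰ 𝐓)) ≡ initialSign 𝐓 v *ₛ finalSign (stage 𝐓) v
  ∏-poleSign ⟨ T ⟩ v with any? (λ a → a ≟ v)
  -- There are no cubes: the empty product is `-1ₛ *ₛ -1ₛ`, as every vertex of the first
  -- quadrangulation is both initial and final.
  ... | yes _ = refl
  ... | no v∉ = ⊥-elim (v∉ (v , refl))
  ∏-poleSign (𝐓 ▷ φ) zero = trans poleSign-zero (sym (cong (if_then -1ₛ else 1ₛ) (dec-true (any? _) (w , vertexOf′-w))))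
    where
    open Flip φ
    open Attach (stage 𝐓) φ
    open AttachCount (stage 𝐓) φ (stage-consistent 𝐓)
  ∏-poleSign (𝐓 ▷ φ) (suc v) = begin
    ∏ₛ (Complex.cornersAt (ϰ (𝐓 ▷ φ)) (suc v)) (poleSignAt (ϰ (𝐓 ▷ φ)))
      ≡⟨ poleSign-suc v ⟩
    removed *ₛ ∏ₛ (cornersAt v) (poleSignAt (ϰ 𝐓))
      ≡⟨ cong (removed *ₛ_) (∏-poleSign 𝐓 v) ⟩
    removed *ₛ (initialSign 𝐓 v *ₛ finalSign (stage 𝐓) v)
      ≡⟨ Sign.*-assoc removed (initialSign 𝐓 v) _ ⟨
    removed *ₛ initialSign 𝐓 v *ₛ finalSign (stage 𝐓) v
      ≡⟨ cong (_*ₛ finalSign (stage 𝐓) v) (Sign.*-comm removed (initialSign 𝐓 v)) ⟩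
    initialSign 𝐓 v *ₛ removed *ₛ finalSign (stage 𝐓) v
      ≡⟨ Sign.*-assoc (initialSign 𝐓 v) removed _ ⟩
    initialSign 𝐓 v *ₛ (removed *ₛ finalSign (stage 𝐓) v)
      ≡⟨ cong (initialSign 𝐓 v *ₛ_) (final (vertexOf w ≟ v)) ⟩
    initialSign 𝐓 v *ₛ finalSign (stage (𝐓 ▷ φ)) (suc v)
      ∎
    where
    open Stage (stage 𝐓)
    open Consistent (stage-consistent 𝐓)
    open Flip φ
    open Attach (stage 𝐓) φ
    open AttachCount (stage 𝐓) φ (stage-consistent 𝐓)
    open ≡-Reasoning

    removed : Sign
    removed = if does (vertexOf w ≟ v) then -1ₛ else 1ₛ

    descend : ∀ {a} → vertexOf′ (stage 𝐓) φ a ≡ suc v → a ≢ w × vertexOf a ≡ v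
    descend {a} eq with a ≟ w
    descend () | yes _
    ... | no a≢w = a≢w , suc-injective eq

    -- The flip takes `w` off the top, so among the old vertices `finalSign` changes, from `-1ₛ` to
    -- `1ₛ`, exactly at `vertexOf w`; the factor `removed` accounts for this change.
    final : (d : Dec (vertexOf w ≡ v)) →
            (if does d then -1ₛ else 1ₛ) *ₛ finalSign (stage 𝐓) v ≡ finalSign (stage (𝐓 ▷ φ)) (suc v)
    final (yes refl)
      rewrite dec-true (any? (λ a → vertexOf a ≟ vertexOf w)) (w , refl)
            | dec-false (any? (λ a → vertexOf′ (stage 𝐓) φ a ≟ suc (vertexOf w)))
                (λ (a , eq) → let a≢w , eq′ = descend eq in a≢w (vertexOf-injective eq′)) = refl
    final (no w≢v) with any? (λ a → vertexOf a ≟ v)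
    ... | yes (a , refl)
      rewrite dec-true (any? (λ b → vertexOf′ (stage 𝐓) φ b ≟ suc (vertexOf a)))
                (a , vertexOf′-≢ (λ a≡w → w≢v (cong vertexOf (sym a≡w)))) = refl
    ... | no v∉
      rewrite dec-false (any? (λ b → vertexOf′ (stage 𝐓) φ b ≟ suc v))
                (λ (a , eq) → v∉ (a , proj₂ (descend eq))) = refl

  module _ {R : Polygon n} {T : Quadrangulation R m} (𝐓 : Pile T) where
    open Stage (stage 𝐓)
    open Consistent (stage-consistent 𝐓)

    interior-count : ∀ v S → Interior v → v ∈ toList (corners S) → ¬ count complex v S ≤ 1
    interior-count v S int v∈S ≤1 =
      2≰1 (subst (_≤ 1) (Interior.two-cubes int S (∈-filter⁺ (λ S → v ∈? toList (corners S)) (∈-allFin S) v∈S)) ≤1)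
      where
      2≰1 : ¬ 2 ≤ 1
      2≰1 (s≤s ())

    -- A vertex of the first or last quadrangulation lies on one of its faces, and that face is in
    -- at most one cube at the vertex, having no cube below it or none above it. `two-cubes` asks
    -- for two, so an interior vertex is neither initial nor final and both factors of `∏-poleSign`
    -- are `1ₛ`.
    interior-poleSign : ∀ v → Interior v → ∏ₛ (cornersAt v) (poleSignAt complex) ≡ 1ₛ
    interior-poleSign v int = trans (∏-poleSign 𝐓 v) (cong₂ _*ₛ_ (notInitial (initialSign 𝐓 v) refl) notFinal)
      where
      notInitial : ∀ s → initialSign 𝐓 v ≡ s → s ≡ 1ₛ
      notInitial 1ₛ  _  = refl
      notInitial -1ₛ eq = let S , v∈S , init = initialSign-face 𝐓 v eq in
        ⊥-elim (interior-count v S int v∈S (count-initial 𝐓 S v init))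

      notFinal : finalSign (stage 𝐓) v ≡ 1ₛ
      notFinal with any? (λ a → vertexOf a ≟ v)
      ... | no _ = refl
      ... | yes (a , refl) = let f , a∈f = Quadrangulation.vertices-covered T a in
        ⊥-elim (interior-count v (faceOf f) int
          (subst (λ q → v ∈ toList q) (sym (corners-faceOf f)) (∈-map-Quad vertexOf _ a∈f)) (count-faceOf 𝐓 f v))

open Combinatorics

-- Products over cubes and faces.

module Products {c ℓ₁ ℓ₂} (𝔽 : ScalarField c ℓ₁ ℓ₂) where
  open ScalarField 𝔽
  open HeytingCommutativeRing heytingCommutativeRing using (commutativeRing)
  open Algebra.Apartness.Properties.HeytingCommutativeRing heytingCommutativeRing
  open Algebra.Properties.Semiring.Exp (CommutativeRing.semiring commutativeRing) using (_^_)
  open IntegerRingSolver commutativeRing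
  open Hexahedra 𝔽
  open Relation.Binary.Reasoning.Setoid setoid

  private
    variable
      m : ℕ
      A V W : Set

  ∏-cong : (xs : List A) {f g : A → Carrier} → (∀ {x} → x ∈ xs → f x ≈ g x) → ∏ 𝔽 xs f ≈ ∏ 𝔽 xs g
  ∏-cong []       eq = refl
  ∏-cong (x ∷ xs) eq = *-cong (eq (here ≡.refl)) (∏-cong xs (eq ∘ there))

  ∏-* : (xs : List A) (f g : A → Carrier) → ∏ 𝔽 xs (λ x → f x * g x) ≈ ∏ 𝔽 xs f * ∏ 𝔽 xs g
  ∏-* []       f g = sym (*-identityˡ 1#)
  ∏-* (x ∷ xs) f g = trans (*-congˡ (∏-* xs f g))
    (identity (a :* b :* (c′ :* d)) (a :* c′ :* (b :* d)) _ (f x ∷ g x ∷ ∏ 𝔽 xs f ∷ ∏ 𝔽 xs g ∷ []))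
    where
    a  = var {4} 0F
    b  = var {4} 1F
    c′ = var {4} 2F
    d  = var {4} 3F

  ∏-1 : (xs : List A) → ∏ 𝔽 xs (λ _ → 1#) ≈ 1#
  ∏-1 []       = refl
  ∏-1 (x ∷ xs) = trans (*-identityˡ _) (∏-1 xs)

  ∏-filter : {P : Pred A 0ℓ} (P? : Decidable P) (f : A → Carrier) (xs : List A) →
             ∏ 𝔽 (filter P? xs) f ≈ ∏ 𝔽 xs (λ x → if does (P? x) then f x else 1#)
  ∏-filter P? f []       = refl
  ∏-filter P? f (x ∷ xs) with does (P? x)
  ... | true  = *-congˡ (∏-filter P? f xs)
  ... | false = trans (∏-filter P? f xs) (sym (*-identityˡ _))

  ∏-↭ : {xs ys : List A} (f : A → Carrier) → xs ↭ ys → ∏ 𝔽 xs f ≈ ∏ 𝔽 ys f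
  ∏-↭ f ↭.refl          = refl
  ∏-↭ f (↭.prep x p)    = *-congˡ (∏-↭ f p)
  ∏-↭ f (↭.swap x y p)  = trans (*-congˡ (*-congˡ (∏-↭ f p)))
    (trans (sym (*-assoc _ _ _)) (trans (*-congʳ (*-comm _ _)) (*-assoc _ _ _)))
  ∏-↭ f (↭.trans p q)   = trans (∏-↭ f p) (∏-↭ f q)

  ∏-#0 : (xs : List A) {f : A → Carrier} → (∀ x → f x # 0#) → ∏ 𝔽 xs f # 0#
  ∏-#0 []       f#0 = 1#0
  ∏-#0 (x ∷ xs) f#0 = x#0y#0→xy#0 (f#0 x) (∏-#0 xs f#0)

  ∏-σ : (xs : List A) (s : A → Sign) → ∏ 𝔽 xs (σ ∘ s) ≈ σ (∏ₛ xs s)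
  ∏-σ []       s = refl
  ∏-σ (x ∷ xs) s = trans (*-congˡ (∏-σ xs s)) (sym (σ-homo (s x) (∏ₛ xs s)))

  σ≈1⇒≡1 : ∀ s → σ s ≈ 1# → s ≡ 1ₛ
  σ≈1⇒≡1 1ₛ  _    = ≡.refl
  σ≈1⇒≡1 -1ₛ -1≈1 = ⊥-elim (#-irrefl (begin
    1# + 1#     ≈⟨ +-congʳ -1≈1 ⟨
    - 1# + 1#   ≈⟨ -‿inverseˡ 1# ⟩
    0#          ∎) 2#0)

  module _ (faces : A → List (Fin m)) (g : Fin m → Carrier) where
    private
      on? : ∀ S x → Dec (S ∈ faces x)
      on? S x = S ∈? faces x

    -- The product over incidences is regrouped by faces. Uniqueness makes `faces x` a permutation
    -- of the sublist of `Ss` that it selects, so each `x` contributes one factor `g S` for every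
    -- `S` on it.
    double-count : (Ss : List (Fin m)) → Unique Ss → (xs : List A) →
      (∀ {x} → x ∈ xs → Unique (faces x)) → (∀ {x S} → x ∈ xs → S ∈ faces x → S ∈ Ss) →
      ∏ 𝔽 xs (λ x → ∏ 𝔽 (faces x) g) ≈ ∏ 𝔽 Ss (λ S → g S ^ length (filter (on? S) xs))
    double-count Ss Ss! []       faces! faces⊆ = sym (∏-1 Ss)
    double-count Ss Ss! (x ∷ xs) faces! faces⊆ = begin
      ∏ 𝔽 (faces x) g * ∏ 𝔽 xs (λ x → ∏ 𝔽 (faces x) g)
        ≈⟨ *-cong (∏-↭ g (∼bag⇒↭ (unique∧set⇒bag (faces! (here ≡.refl)) (Unique.filter⁺ (λ S → on? S x) Ss!)
             (mk⇔ (λ S∈ → ∈-filter⁺ (λ S → on? S x) (faces⊆ (here ≡.refl) S∈) S∈)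
                  (λ S∈ → proj₂ (∈-filter⁻ (λ S → on? S x) {xs = Ss} S∈))))))
             (double-count Ss Ss! xs (faces! ∘ there) (faces⊆ ∘ there)) ⟩
      ∏ 𝔽 (filter (λ S → on? S x) Ss) g * ∏ 𝔽 Ss (power xs)
        ≈⟨ *-congʳ (∏-filter (λ S → on? S x) g Ss) ⟩
      ∏ 𝔽 Ss (λ S → if does (on? S x) then g S else 1#) * ∏ 𝔽 Ss (power xs)
        ≈⟨ ∏-* Ss (λ S → if does (on? S x) then g S else 1#) (power xs) ⟨
      ∏ 𝔽 Ss (λ S → (if does (on? S x) then g S else 1#) * power xs S)
        ≈⟨ ∏-cong Ss (λ {S} _ → step S) ⟩
      ∏ 𝔽 Ss (power (x ∷ xs))
        ∎
      where
      power : List A → Fin m → Carrier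
      power xs S = g S ^ length (filter (on? S) xs)

      step : ∀ S → (if does (on? S x) then g S else 1#) * power xs S ≈ power (x ∷ xs) S
      step S with does (on? S x)
      ... | true  = refl
      ... | false = *-identityˡ _

  diagonals-≋ : (x : V → Carrier) {p q : Quad V} → p ≋ q → diagonals 𝔽 x p ≈ diagonals 𝔽 x q
  diagonals-≋ x {q = a ∷ b ∷ c′ ∷ d ∷ []} = cases
    where
    ca = *-comm (x c′) (x a)
    db = *-comm (x d) (x b)
    cases : ∀ {p} → p ≋ (a ∷ b ∷ c′ ∷ d ∷ []) → diagonals 𝔽 x p ≈ x a * x c′ + x b * x d
    cases at₀ = refl
    cases at₁ = trans (+-comm _ _) (+-congʳ ca)
    cases at₂ = +-cong ca db
    cases at₃ = trans (+-comm _ _) (+-congˡ db)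
    cases at₄ = trans (+-comm _ _) (+-cong ca db)
    cases at₅ = +-congʳ ca
    cases at₆ = +-comm _ _
    cases at₇ = +-congˡ db

  diagonals-map : (x : W → Carrier) (g : V → W) (q : Quad V) →
                  diagonals 𝔽 x (Vec.map g q) ≡ diagonals 𝔽 (x ∘ g) q
  diagonals-map x g (_ ∷ _ ∷ _ ∷ _ ∷ []) = ≡.refl

-- Extension up to signs, and correction of the signs.

module Extension {c ℓ₁ ℓ₂} (𝔽 : ScalarField c ℓ₁ ℓ₂) where
  open ScalarField 𝔽 hiding (zero)
  open HeytingCommutativeRing heytingCommutativeRing using (commutativeRing)
  open IntegerRingSolver commutativeRing
  open Hexahedra 𝔽
  open Products 𝔽
  open Relation.Binary.Reasoning.Setoid setoid

  private
    variable
      n m : ℕ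

  -- The values `face` are global, the defect `sign` is local to a cube. Placing it on the first
  -- direction is a convention: a change of sign on two directions preserves the equations, so it
  -- can be moved to either of the others.
  record SignedExtension (K : Complex) (x : Fin (Complex.#⁰ K) → Carrier) : Set (c ⊔ ℓ₁) where
    open Complex K
    field
      face       : Fin #² → Carrier
      sign       : Fin #³ → Sign
      face²      : ∀ S → face S ² ≈ diagonals 𝔽 x (corners S)
      hexahedron : ∀ C → let open Cube (cube C) in
        Hexahedron (λ i j k → x (vertex i j k))
          (σ (sign C) * face (face₁ O)) (σ (sign C) * face (face₁ I))
          (face (face₂ O)) (face (face₂ I)) (face (face₃ O)) (face (face₃ I))

  -- Square roots are chosen freely only on the first quadrangulation; each later face is forced by
  -- the cube below it. The face quantities are apart from zero, hence so are the roots, which is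
  -- what allows a sign to be extracted from the equality of squares.
  signedExtension : {R : Polygon n} {T : Quadrangulation R m} (𝐓 : Pile T) → let open Complex (ϰ 𝐓) in
    (x : Fin #⁰ → Carrier) → (∀ C → KashaevAt 𝔽 (ϰ 𝐓) x C ≈ 0#) → (∀ v → x v # 0#) →
    (∀ S → diagonals 𝔽 x (corners S) # 0#) → SignedExtension (ϰ 𝐓) x
  signedExtension ⟨ T ⟩ x K≈0 x#0 D#0 = record
    { face       = λ S → proj₁ (sqrt _ (D#0 S))
    ; sign       = λ ()
    ; face²      = λ S → proj₂ (sqrt _ (D#0 S))
    ; hexahedron = λ ()
    }
  signedExtension (𝐓 ▷ φ) x K≈0 x#0 D#0 = record
    { face       = face′
    ; sign       = sign′
    ; face²      = face²′
    ; hexahedron = λ where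
        zero    → H.hexahedron
        (suc C) → E.hexahedron C
    }
    where
    open Stage (stage 𝐓)
    open Flip φ
    module S′ = Stage (stage (𝐓 ▷ φ))
    module Coh = Consistent (stage-consistent (𝐓 ▷ φ))

    module E = SignedExtension (signedExtension 𝐓 (x ∘ suc) (K≈0 ∘ suc) (x#0 ∘ suc)
      (λ S → ≡.subst (_# 0#) (diagonals-map x suc (corners S)) (D#0 (3 ↑ʳ S))))

    z : Bool → Bool → Bool → Carrier
    z i j k = x (newVertex (stage 𝐓) φ i j k)

    old² : ∀ S → E.face S ² ≈ diagonals 𝔽 x (S′.corners (3 ↑ʳ S))
    old² S = trans (E.face² S) (reflexive (≡.sym (diagonals-map x suc (corners S))))

    old#0 : ∀ S → E.face S # 0#
    old#0 S = factor#0 (old² S) (D#0 (3 ↑ʳ S))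

    module H = NewHexahedron z (x#0 _) (K≈0 zero) (E.face (faceOf t₁)) (E.face (faceOf t₂)) (E.face (faceOf t₃))
      (old#0 _) (old#0 _) (old#0 _)
      (trans (old² (faceOf t₁)) (diagonals-≋ x (Coh.incident₁ zero O)))
      (trans (old² (faceOf t₂)) (diagonals-≋ x (Coh.incident₂ zero O)))
      (trans (old² (faceOf t₃)) (diagonals-≋ x (Coh.incident₃ zero O)))

    face′ : Fin S′.#² → Carrier
    face′ 0F                  = H.opposite₁
    face′ 1F                  = H.opposite₂
    face′ 2F                  = H.opposite₃
    face′ (suc (suc (suc S))) = E.face S

    sign′ : Fin S′.#³ → Sign
    sign′ zero    = H.sign
    sign′ (suc C) = E.sign C

    face²′ : ∀ S → face′ S ² ≈ diagonals 𝔽 x (S′.corners S)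
    face²′ 0F = trans (sym (σ-square-* H.sign H.opposite₁))
      (trans (Parametrisation.square₁′ (x#0 _) H.hexahedron) (sym (diagonals-≋ x (Coh.incident₁ zero I))))
    face²′ 1F = trans (Parametrisation.square₂′ (x#0 _) H.hexahedron) (sym (diagonals-≋ x (Coh.incident₂ zero I)))
    face²′ 2F = trans (Parametrisation.square₃′ (x#0 _) H.hexahedron) (sym (diagonals-≋ x (Coh.incident₃ zero I)))
    face²′ (suc (suc (suc S))) = old² S

  module _ {R : Polygon n} {T : Quadrangulation R m} (𝐓 : Pile T) (x : Fin (Complex.#⁰ (ϰ 𝐓)) → Carrier)
           (x#0 : ∀ v → x v # 0#) (extension : SignedExtension (ϰ 𝐓) x) where
    open Complex (ϰ 𝐓)
    open Consistent (stage-consistent 𝐓)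
    open SignedExtension extension

    kashaev-corner : ∀ c → KashaevAtCorner 𝔽 (ϰ 𝐓) x c ≈
      σ (sign (proj₁ c)) * σ (poleSignAt (ϰ 𝐓) c) * ∏ 𝔽 (cornerFaces c) (λ S → - face S)
    kashaev-corner (C , i , j , k) = trans (signed-kashaev₀₀₀≈ (sign C) (x#0 _) (hexahedron C) i j k)
      (*-congˡ (*-cong (select face₁ i) (*-cong (select face₂ j) (*-congʳ (select face₃ k)))))
      where
      open Cube (cube C)
      select : ∀ (h : Bool → Fin #²) b → - (if b then face (h I) else face (h O)) ≈ - face (h b)
      select h O = refl
      select h I = refl

    ∏-faces : ∀ v → Interior v →
      ∏ 𝔽 (cornersAt v) (λ c → ∏ 𝔽 (cornerFaces c) (λ S → - face S)) ≈
      ∏ 𝔽 (facesAt v) (λ S → diagonals 𝔽 x (corners S))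
    ∏-faces v int = trans
      (double-count cornerFaces (λ S → - face S) (facesAt v) (Unique.filter⁺ at? (Unique.allFin⁺ #²)) (cornersAt v)
        (λ {c} _ → faces-distinct c)
        (λ {c} {S} c∈ S∈ → ∈-filter⁺ at? (∈-allFin S)
          (≡.subst (_∈ toList (corners S)) (∈-cornersAt⁻ (ϰ 𝐓) c∈) (cornerFaces⊆facesAt c S∈))))
      (∏-cong (facesAt v) λ {S} S∈ → trans (reflexive (≡.cong ((- face S) ^_) (Interior.two-cubes int S S∈)))
        (trans (identity (:- F :* (:- F :* con (+ 1))) (F :* F) _ (face S ∷ [])) (face² S)))
      where
      open Algebra.Properties.Semiring.Exp (CommutativeRing.semiring commutativeRing) using (_^_)
      F = var {1} 0F
      at? : ∀ S → Dec (v ∈ toList (corners S))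
      at? S = v ∈? toList (corners S)

    ∏-sign : CoherentSolution 𝔽 (ϰ 𝐓) x → (∀ S → diagonals 𝔽 x (corners S) # 0#) →
             ∀ v → Interior v → ∏ₛ (cornersAt v) (sign ∘ proj₁) ≡ 1ₛ
    -- Coherence determines the product of the signs only after cancelling `D`, which is apart from
    -- zero because every face quantity is.
    ∏-sign solution D#0 v int = σ≈1⇒≡1 U (*-cancelˡ (∏-#0 (facesAt v) D#0) (begin
      D * σ U                       ≈⟨ *-comm D (σ U) ⟩
      σ U * D                       ≈⟨ *-congʳ (*-identityʳ (σ U)) ⟨
      σ U * 1# * D                  ≡⟨ ≡.cong (λ s → σ U * σ s * D) (interior-poleSign 𝐓 v int) ⟨
      σ U * σ (∏ₛ cs pole) * D
        ≈⟨ *-cong (*-cong (∏-σ cs (sign ∘ proj₁)) (∏-σ cs pole)) (∏-faces v int) ⟨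
      ∏ 𝔽 cs (σ ∘ sign ∘ proj₁) * ∏ 𝔽 cs (σ ∘ pole) * ∏ 𝔽 cs P
        ≈⟨ *-congʳ (∏-* cs (σ ∘ sign ∘ proj₁) (σ ∘ pole)) ⟨
      ∏ 𝔽 cs (λ c → σ (sign (proj₁ c)) * σ (pole c)) * ∏ 𝔽 cs P
        ≈⟨ ∏-* cs (λ c → σ (sign (proj₁ c)) * σ (pole c)) P ⟨
      ∏ 𝔽 cs (λ c → σ (sign (proj₁ c)) * σ (pole c) * P c)
        ≈⟨ ∏-cong cs (λ {c} _ → kashaev-corner c) ⟨
      ∏ 𝔽 cs (KashaevAtCorner 𝔽 (ϰ 𝐓) x)
        ≈⟨ CoherentSolution.coherent solution v int ⟩
      D                             ≈⟨ *-identityʳ D ⟨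
      D * 1#                        ∎))
      where
      cs = cornersAt v
      U = ∏ₛ cs (sign ∘ proj₁)
      D = ∏ 𝔽 (facesAt v) (λ S → diagonals 𝔽 x (corners S))
      pole = poleSignAt (ϰ 𝐓)
      P : Corner → Carrier
      P c = ∏ 𝔽 (cornerFaces c) (λ S → - face S)

    -- `rescale` is applied with the class signs of the second and third directions. By `ψ≡`, the
    -- class sign of the first direction is their product times `sign C`, so on that pair the
    -- correction also absorbs the defect; constancy on classes gives both faces of a pair the same
    -- sign.
    kHexahedron : ((t , t-∼) : ClassSigns) → (∀ C → ψ (t , t-∼) C ≡ sign C) →
                  KHexahedron 𝔽 (ϰ 𝐓) [ x , (λ S → σ (t S) * face S) ]
    kHexahedron (t , t-∼) ψ≡ = record
      { nonzero  = x#0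
      ; face-eq  = λ S → trans (σ-square-* (t S) (face S)) (face² S)
      ; cube-eqs = λ C → let open Cube (cube C) in
          rescale (x#0 (vertex O O O)) (hexahedron C) (t (face₂ O)) (t (face₃ O))
            (first C (face₁ O) ≡.refl) (first C (face₁ I) (invariant (opposite₁ C)))
            refl (other (face₂ I) (invariant (opposite₂ C)))
            refl (other (face₃ I) (invariant (opposite₃ C)))
      }
      where
      invariant : ∀ {S S′} → Opposite S S′ → t S′ ≡ t S
      invariant opp = ≡.sym (t-∼ (EqClosure.return opp))

      other : ∀ {s} S → t S ≡ s → σ (t S) * face S ≈ σ s * face S
      other S ≡.refl = refl

      cancel : ∀ p q r → q *ₛ r *ₛ (p *ₛ q *ₛ r) ≡ p
      cancel 1ₛ  1ₛ  1ₛ  = ≡.refl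
      cancel 1ₛ  1ₛ  -1ₛ = ≡.refl
      cancel 1ₛ  -1ₛ 1ₛ  = ≡.refl
      cancel 1ₛ  -1ₛ -1ₛ = ≡.refl
      cancel -1ₛ 1ₛ  1ₛ  = ≡.refl
      cancel -1ₛ 1ₛ  -1ₛ = ≡.refl
      cancel -1ₛ -1ₛ 1ₛ  = ≡.refl
      cancel -1ₛ -1ₛ -1ₛ = ≡.refl

      first : ∀ C S → let open Cube (cube C) in t S ≡ t (face₁ O) →
              σ (t S) * face S ≈ σ (t (face₂ O)) * σ (t (face₃ O)) * (σ (sign C) * face S)
      first C S eq = begin
        σ (t S) * face S
          ≡⟨ ≡.cong (λ s → σ s * face S) (≡.trans eq (≡.sym (cancel (t (face₁ O)) q r))) ⟩
        σ (q *ₛ r *ₛ (t (face₁ O) *ₛ q *ₛ r)) * face S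
          ≡⟨ ≡.cong (λ s → σ (q *ₛ r *ₛ s) * face S) (ψ≡ C) ⟩
        σ (q *ₛ r *ₛ sign C) * face S
          ≈⟨ *-congʳ (trans (σ-homo (q *ₛ r) (sign C)) (*-congʳ (σ-homo q r))) ⟩
        σ q * σ r * σ (sign C) * face S
          ≈⟨ *-assoc _ _ _ ⟩
        σ q * σ r * (σ (sign C) * face S)
          ∎
        where
        open Cube (cube C)
        q = t (face₂ O)
        r = t (face₃ O)

theorem8p10 : ∀ {c ℓ₁ ℓ₂} (𝔽 : ScalarField c ℓ₁ ℓ₂) →
    let open ScalarField 𝔽 in
    {n m : ℕ} {R : Polygon n} {T : Quadrangulation R m} (𝐓 : Pile T) →
    let open Complex (ϰ 𝐓) in
    Comfortable →
    (x : Fin #⁰ → Carrier) →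
    CoherentSolution 𝔽 (ϰ 𝐓) x →
    (∀ v → x v # 0#) →
    (∀ S → diagonals 𝔽 x (corners S) # 0#) →
    Σ[ x̃ ∈ (Fin #⁰ ⊎ Fin #² → Carrier) ] ((∀ v → x̃ (inj₁ v) ≈ x v) × KHexahedron 𝔽 (ϰ 𝐓) x̃)
theorem8p10 𝔽 𝐓 comfortable x solution x#0 D#0 =
  let t , ψt≡sign = comfortable sign (∏-sign 𝐓 x x#0 extension solution D#0)
  in [ x , (λ S → σ (proj₁ t S) * face S) ] , (λ _ → refl) , kHexahedron 𝐓 x x#0 extension t ψt≡sign
  where
  open ScalarField 𝔽 using (_*_; refl)
  open Hexahedra 𝔽 using (σ)
  open Extension 𝔽
  extension = signedExtension 𝐓 x (CoherentSolution.solution solution) x#0 D#0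
  open SignedExtension extension
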